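{- Let $m \geq 1$ be an integer and let $n \geq 2^m$ be an even integer. Then the hypercube $Q_n$ can be decomposed into cycles $C_1, C_2, \dots, C_r$, each of length $2^m n$, where $r = 2^{n-1-m}$, such that (I) every $C_i$ contains $2^m$ edges $e_{i1}, e_{i2}, \dots, e_{i2^m}$ such that the graph $C_i - \{e_{i1}, \dots, e_{i2^m}\}$ has exactly $2^m$ components, each of which is a path of length $n-1$; and (II) the set $M = \{e_{ij} : j = 1, \dots, 2^m;\ i = 1, \dots, r\}$ is a perfect matching of $Q_n$.
   Context: $Q_n$ is the $n$-dimensional hypercube (vertices: binary $n$-tuples; edges: pairs differing in exactly one coordinate). A decomposition into cycles means a partition of the edge set into edge sets of cycles. The length of a cycle or path is its number of edges. A perfect matching is a set of pairwise vertex-disjoint edges covering every vertex. -}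

module Defs where

open import Data.Bool using (Bool)
open import Data.Nat using (ℕ; suc; _≤_; _^_; _*_; _∸_; _%_)
open import Data.Nat.DivMod using (m%n<n)
open import Data.Fin using (Fin; toℕ; fromℕ<)
open import Data.Vec using (Vec; lookup)
open import Data.Product using (Σ; proj₁; proj₂; ∃; ∃-syntax; _×_; _,_)
open import Data.Sum using (_⊎_)
open import Relation.Nullary using (¬_)
open import Relation.Binary.PropositionalEquality using (_≡_; _≢_)
open import Function.Bundles using (_⇔_)

Vertex : ℕ → Set
Vertex n = Vec Bool n

Adjacent : ∀ {n} → Vertex n → Vertex n → Set
Adjacent {n} u v = ∃[ k ] (lookup u k ≢ lookup v k
                   × (∀ (j : Fin n) → j ≢ k → lookup u j ≡ lookup v j))

Edge : ℕ → Set
Edge n = Vertex n × Vertex n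

SameEdge : ∀ {n} → Edge n → Edge n → Set
SameEdge (a , b) (c , d) = (a ≡ c × b ≡ d) ⊎ (a ≡ d × b ≡ c)

next : ∀ {L} → Fin L → Fin L
next {suc k} i = fromℕ< (m%n<n (suc (toℕ i)) (suc k))

Injective : ∀ {A B : Set} → (A → B) → Set
Injective f = ∀ x y → f x ≡ f y → x ≡ y

IsCycle : ∀ {n} L → (Fin L → Vertex n) → Set
IsCycle L c = 3 ≤ L × Injective c × (∀ t → Adjacent (c t) (c (next t)))

cycEdge : ∀ {n L} → (Fin L → Vertex n) → Fin L → Edge n
cycEdge c t = (c t , c (next t))

Consecutive : ∀ {k} → Fin k → Fin k → Set
Consecutive s s' = toℕ s' ≡ suc (toℕ s)

IsCycleDecomposition : ∀ n r L → (Fin r → Fin L → Vertex n) → Set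
IsCycleDecomposition n r L C =
    (∀ i → IsCycle L (C i))
  × (∀ (u v : Vertex n) → Adjacent u v → ∃[ i ] ∃[ t ] SameEdge (cycEdge (C i) t) (u , v))
  × (∀ i i' t t' → SameEdge (cycEdge (C i) t) (cycEdge (C i') t') → i ≡ i')

RemEdge : ∀ {n L q} → (Fin L → Vertex n) → (Fin q → Edge n) → Edge n → Set
RemEdge c e x = (∃[ t ] SameEdge (cycEdge c t) x) × ¬ (∃[ j ] SameEdge (e j) x)

-- The graph c − {e j} has exactly q components, each a path of length k − 1
-- (k vertices): it is the vertex-disjoint union of q paths P 0 … P (q-1),
-- each with k distinct vertices, whose vertex sets cover V(c) and whose
-- edge sets together are exactly the edge set of c − {e j}.
ComponentsArePaths : ∀ {n L q} → (Fin L → Vertex n) → (Fin q → Edge n) → ℕ → Set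
ComponentsArePaths {n} {L} {q} c e k =
  Σ (Fin q → Fin k → Vertex n) λ P → ((∀ (a : Fin q) → Injective (P a))
    × (∀ a a' s s' → P a s ≡ P a' s' → a ≡ a')
    × (∀ (v : Vertex n) → (∃[ t ] c t ≡ v) ⇔ (∃[ a ] ∃[ s ] P a s ≡ v))
    × (∀ (x : Edge n) → RemEdge c e x ⇔
         (∃[ a ] ∃[ s ] ∃[ s' ] (Consecutive s s' × SameEdge (P a s , P a s') x))))

PropertyI : ∀ {n L q} → (Fin L → Vertex n) → (Fin q → Edge n) → ℕ → Set
PropertyI c e k =
    (∀ j → ∃[ t ] SameEdge (e j) (cycEdge c t))
  × (∀ j j' → SameEdge (e j) (e j') → j ≡ j')
  × ComponentsArePaths c e k

Endpoint : ∀ {n} → Vertex n → Edge n → Set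
Endpoint v (a , b) = (v ≡ a) ⊎ (v ≡ b)

IsPerfectMatching : ∀ n r q → (Fin r → Fin q → Edge n) → Set
IsPerfectMatching n r q e =
    (∀ i j → Adjacent (proj₁ (e i j)) (proj₂ (e i j)))
  × (∀ (v : Vertex n) → ∃[ i ] ∃[ j ] Endpoint v (e i j))
  × (∀ (v : Vertex n) i j i' j' → Endpoint v (e i j) → Endpoint v (e i' j')
       → SameEdge (e i j) (e i' j'))

{-# OPTIONS --safe #-}

-- Let φ : F₂ⁿ → F₂^(m+1) be linear and onto, with kernel V.  Suppose a closed word in the n directions traces a simple
-- cycle of Q_n and its image under φ is an Eulerian circuit of the Cayley multigraph of F₂^(m+1) with generators φ(e_d).
-- Then the V-translates of the cycle decompose Q_n, and if one letter z occurs at every n-th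
-- place and nowhere else, the edges in direction z form the matching M.
-- Such words arise by inserting new letters into old ones.  Two new letters labelled φ(e_z) in front of each z lead from
-- n to n + 2; going twice around the word with four new letters, all labelled by a new basis vector, leads from (m , n)
-- to (m + 1 , n + 4).  Explicit words for (1 , 2), (2 , 6) and (3 , 8) start the induction; (2 , 4) is treated separately.

module Submission where

open import Defs
open import Data.Bool using (Bool; true; false; not; _xor_; if_then_else_)
import Data.Bool as Bool
open import Data.Bool.Properties using (not-involutive; not-¬; not-distribʳ-xor; xor-comm; xor-assoc; xor-identityʳ)
open import Data.Fin using (Fin; zero; suc; toℕ; fromℕ; fromℕ<; combine; punchIn; punchOut; _↑ˡ_; _↑ʳ_)
import Data.Fin as Fin
open import Data.Fin.Patterns using (0F; 1F; 2F; 3F; 4F; 5F; 6F; 7F)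
open import Data.Fin.Properties using (toℕ-injective; toℕ-fromℕ<; toℕ<n; toℕ-combine; toℕ-fromℕ; combine-remQuot; combine-injective; injective⇒≤; punchIn-punchOut; *↔×; 2↔Bool)
import Data.Fin.Properties as Finₚ
open import Data.List using (List; []; _∷_; _++_; length; map)
open import Data.List.Properties using (length-++; length-map; map-++; ++-assoc)
open import Data.List.Membership.Propositional using (_∈_; find)
open import Data.List.Membership.Propositional.Properties using (∈-++⁺ˡ; ∈-++⁺ʳ; ∈-++⁻; ∈-map⁻)
open import Data.List.Relation.Binary.Permutation.Propositional using (_↭_; ↭-trans; ↭-reflexive; ↭⇒↭ₛ)
open import Data.List.Relation.Binary.Permutation.Propositional.Properties using (++⁺ˡ; shifts; ++-comm)
import Data.List.Relation.Binary.Permutation.Setoid.Properties as Permutationₛ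
open import Data.List.Relation.Unary.All using (All; []; _∷_)
import Data.List.Relation.Unary.All as All
import Data.List.Relation.Unary.All.Properties as Allₚ
open import Data.List.Relation.Unary.AllPairs using ([]; _∷_)
open import Data.List.Relation.Unary.Any using (Any; here; there; any?)
open import Data.List.Relation.Unary.Unique.DecPropositional using (unique?)
open import Data.List.Relation.Unary.Unique.Propositional using (Unique)
import Data.List.Relation.Unary.Unique.Propositional.Properties as Uniqueₚ
open import Data.Nat using (ℕ; zero; suc; _≤_; _<_; _^_; _*_; _∸_; _+_; z≤n; s≤s; _%_)
import Data.Nat as ℕ
open import Data.Nat.DivMod using (m<n⇒m%n≡m; n%n≡0)
open import Data.Nat.Divisibility using (_∣_; divides)
open import Data.Nat.Properties using (≤-trans; ≤-reflexive; n≤1+n; 1+n≰n; <-irrefl; m≤n⇒m<n∨m≡n; m≤m+n; suc-injective; +-comm; +-assoc; +-suc; +-identityʳ; +-mono-≤; +-cancelˡ-≤; *-comm; *-assoc; *-suc; *-zeroʳ; *-mono-≤; *-cancelʳ-≤; ^-monoʳ-≤; ^-distribˡ-+-*; m∸n+n≡m; m+n∸m≡n)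
open import Data.Product using (Σ; ∃-syntax; _×_; _,_; proj₁; proj₂)
open import Data.Product.Function.NonDependent.Propositional using (_×-↔_)
open import Data.Sum using (_⊎_; inj₁; inj₂)
open import Data.Vec using ([]; _∷_; lookup; updateAt; replicate; foldr′) renaming (_++_ to _++ᵛ_)
open import Data.Vec.Properties using (≡-dec; ∷-injective; ++-injectiveˡ; ++-injectiveʳ; lookup∘updateAt; lookup∘updateAt′; updateAt-updateAt-local; updateAt-id; updateAt-commutes)
open import Data.Vec.Relation.Binary.Pointwise.Extensional using (ext; Pointwise-≡⇒≡)
open import Function using (_∘_; id)
open import Function.Bundles using (_↔_; Inverse; mk⇔; mk↔ₛ′)
open import Function.Construct.Composition using (_↔-∘_)
open import Function.Construct.Identity using (↔-id)
open import Function.Construct.Symmetry using (↔-sym)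
open import Relation.Binary.PropositionalEquality using (_≡_; _≢_; refl; sym; trans; cong; cong₂; subst; setoid)
open import Relation.Nullary using (¬_; Dec; yes; no; ¬?; contradiction)
open import Relation.Nullary.Decidable using (True; toWitness; map′; _×-dec_; _⊎-dec_; _→-dec_)

-- An edge of `Q_n` in direction d lies over an edge of the multigraph labelled d, and a step of the
-- circuit over the latter can be translated by V onto the former. So the translates cover. As
-- 2^(n-1-m) translates of a cycle of length 2^m n make n 2^(n-1) steps, the number of edges of
-- `Q_n`, each edge is covered exactly once. All disjointness of edges comes from such counts;
-- elsewhere only covering is shown. In the passage to m + 1 the two rounds have to use different
-- lifts of every old edge and never meet in a vertex. The lift is read off from the parity of the
-- new coordinates, so the rounds need opposite parities at every old letter. The delicate place is
-- the first block, where the rounds are joined crosswise; there a pair of letters with equal label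
-- gives the room that is missing. The passage adds 4 to n while the bound grows by 2^m, so from m =
-- 3 on the corner cases are reached. The corner (3 , 8) would have to come from (2 , 4), where
-- translates of one cycle fail, and (2 , 6) has the same predecessor under n to n + 2; hence both
-- are given explicitly.

-- Coordinate flips and edges of the cube

flip : ∀ {n} → Fin n → Vertex n → Vertex n
flip d x = updateAt x d not

flip-involutive : ∀ {n} (d : Fin n) x → flip d (flip d x) ≡ x
flip-involutive d x = trans (updateAt-updateAt-local d x (not-involutive _)) (updateAt-id d x)

flip-injective-letter : ∀ {n} {d d' : Fin n} x → flip d x ≡ flip d' x → d ≡ d'
flip-injective-letter {d = zero}  {zero}   (a ∷ x) eq = refl
flip-injective-letter {d = zero}  {suc d'} (false ∷ x) ()
flip-injective-letter {d = zero}  {suc d'} (true ∷ x) ()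
flip-injective-letter {d = suc d} {zero}   (false ∷ x) ()
flip-injective-letter {d = suc d} {zero}   (true ∷ x) ()
flip-injective-letter {d = suc d} {suc d'} (a ∷ x) eq =
  cong suc (flip-injective-letter x (cong (λ { (_ ∷ v) → v }) eq))

adjacent-flip : ∀ {n} (d : Fin n) x → Adjacent x (flip d x)
adjacent-flip d x =
  d , (λ eq → not-¬ refl (trans eq (lookup∘updateAt d x))) , λ j j≢d → sym (lookup∘updateAt′ j d j≢d x)

adjacent⇒flip : ∀ {n} {u v : Vertex n} → Adjacent u v → ∃[ d ] v ≡ flip d u
adjacent⇒flip {n} {u} {v} (d , ne , same) = d , Pointwise-≡⇒≡ (ext pointwise)
  where
  ≢⇒not : ∀ {a b} → a ≢ b → b ≡ not a
  ≢⇒not {false} {false} ne = contradiction refl ne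
  ≢⇒not {false} {true}  ne = refl
  ≢⇒not {true}  {false} ne = refl
  ≢⇒not {true}  {true}  ne = contradiction refl ne
  pointwise : ∀ j → lookup v j ≡ lookup (flip d u) j
  pointwise j with j Fin.≟ d
  ... | yes refl = trans (≢⇒not ne) (sym (lookup∘updateAt d u))
  ... | no j≢d = trans (sym (same j j≢d)) (sym (lookup∘updateAt′ j d j≢d u))

sameEdge-sym : ∀ {n} {e f : Edge n} → SameEdge e f → SameEdge f e
sameEdge-sym (inj₁ (refl , refl)) = inj₁ (refl , refl)
sameEdge-sym (inj₂ (refl , refl)) = inj₂ (refl , refl)

sameEdge-trans : ∀ {n} {e f g : Edge n} → SameEdge e f → SameEdge f g → SameEdge e g
sameEdge-trans (inj₁ (refl , refl)) q = q
sameEdge-trans (inj₂ (refl , refl)) (inj₁ (refl , refl)) = inj₂ (refl , refl)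
sameEdge-trans (inj₂ (refl , refl)) (inj₂ (refl , refl)) = inj₁ (refl , refl)

-- Surjections between finite sets of equal size

-- If two distinct points had the same value, one of them could be dropped; a section of the
-- remaining surjection would inject `suc n` points into `n`.
surjective⇒injective-Fin : ∀ {n} (f : Fin n → Fin n) → (∀ y → ∃[ x ] f x ≡ y) → ∀ {i j} → f i ≡ f j → i ≡ j
surjective⇒injective-Fin {zero} f surj {()}
surjective⇒injective-Fin {suc n} f surj {i} {j} eq with i Fin.≟ j
... | yes i≡j = i≡j
... | no  i≢j = contradiction (injective⇒≤ {f = g} g-injective) 1+n≰n
  where
  avoiding : ∀ y → ∃[ x ] f (punchIn i x) ≡ y
  avoiding y with surj y
  ... | x , fx≡y with i Fin.≟ x
  ...   | yes refl = punchOut i≢j , trans (cong f (punchIn-punchOut i≢j)) (trans (sym eq) fx≡y)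
  ...   | no i≢x = punchOut i≢x , trans (cong f (punchIn-punchOut i≢x)) fx≡y
  g : Fin (suc n) → Fin n
  g y = proj₁ (avoiding y)
  g-injective : ∀ {y y'} → g y ≡ g y' → y ≡ y'
  g-injective {y} {y'} e = trans (sym (proj₂ (avoiding y))) (trans (cong (f ∘ punchIn i) e) (proj₂ (avoiding y')))

surjective⇒injective : ∀ {A B : Set} {a b} → A ↔ Fin a → B ↔ Fin b → a ≡ b →
  (f : A → B) → (∀ y → ∃[ x ] f x ≡ y) → ∀ {x x'} → f x ≡ f x' → x ≡ x'
surjective⇒injective α β refl f surj {x} {x'} eq =
  trans (sym (α.strictlyInverseʳ x)) (trans (cong α.from (surjective⇒injective-Fin h h-surj heq)) (α.strictlyInverseʳ x'))
  where
  module α = Inverse α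
  module β = Inverse β
  h = β.to ∘ f ∘ α.from
  h-surj : ∀ y → ∃[ z ] h z ≡ y
  h-surj y with surj (β.from y)
  ... | z , e = α.to z , trans (cong (β.to ∘ f) (α.strictlyInverseʳ z)) (trans (cong β.to e) (β.strictlyInverseˡ y))
  heq : h (α.to x) ≡ h (α.to x')
  heq = cong β.to (trans (cong f (α.strictlyInverseʳ x)) (trans eq (cong f (sym (α.strictlyInverseʳ x')))))

Vertex↔Fin : ∀ n → Vertex n ↔ Fin (2 ^ n)
Vertex↔Fin zero = mk↔ₛ′ (λ _ → zero) (λ _ → []) (λ { zero → refl }) (λ { [] → refl })
Vertex↔Fin (suc n) = ↔-sym *↔× ↔-∘ ((↔-sym 2↔Bool ×-↔ Vertex↔Fin n) ↔-∘ uncons)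
  where
  uncons : Vertex (suc n) ↔ (Bool × Vertex n)
  uncons = mk↔ₛ′ (λ { (a ∷ x) → a , x }) (λ (a , x) → a ∷ x) (λ _ → refl) (λ { (_ ∷ _) → refl })

toℕ-next : ∀ {L} (t : Fin L) →
  (suc (toℕ t) < L × toℕ (next t) ≡ suc (toℕ t)) ⊎ (suc (toℕ t) ≡ L × toℕ (next t) ≡ 0)
toℕ-next {suc k} t with m≤n⇒m<n∨m≡n (toℕ<n t)
... | inj₁ lt = inj₁ (lt , trans (toℕ-fromℕ< _) (m<n⇒m%n≡m lt))
... | inj₂ eq = inj₂ (eq , trans (toℕ-fromℕ< _) (trans (cong (_% suc k) eq) (n%n≡0 (suc k))))

-- From coverings to decompositions and matchings

Decomposes : ℕ → ℕ → ℕ → Set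
Decomposes m n k =
  ∃[ C ] ∃[ e ]
    (IsCycleDecomposition n (2 ^ k) (2 ^ m * n) C
    × (∀ i → PropertyI (C i) (e i) n)
    × IsPerfectMatching n (2 ^ k) (2 ^ m) e)

-- An edge is recorded by the step (i , t) traversing it, and a vertex by a matched edge with one of its
-- ends.  Counting makes both of these surjections injective, so only the existence half is assumed.
module Assembly (m n' k : ℕ) (1≤m : 1 ≤ m) (1≤n' : 1 ≤ n') (dim : suc m + k ≡ suc n')
  (C : Fin (2 ^ k) → Fin (2 ^ m * suc n') → Vertex (suc n'))
  (ℓ : Fin (2 ^ k) → Fin (2 ^ m * suc n') → Fin (suc n'))
  (step : ∀ i t → C i (next t) ≡ flip (ℓ i t) (C i t))
  (injective : ∀ i {s t} → C i s ≡ C i t → s ≡ t)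
  (traversed : ∀ x d → ∃[ i ] ∃[ t ] (ℓ i t ≡ d × (C i t ≡ x ⊎ flip d (C i t) ≡ x)))
  (matched : ∀ x → ∃[ i ] ∃[ j ] (C i (combine {2 ^ m} j (fromℕ n')) ≡ x ⊎ C i (next (combine {2 ^ m} j (fromℕ n'))) ≡ x))
  where

  n K r N : ℕ
  n = suc n'
  K = 2 ^ m
  r = 2 ^ k
  N = K * n

  2≤K : 2 ≤ K
  2≤K = ^-monoʳ-≤ 2 1≤m

  lastOf : Fin K → Fin N
  lastOf j = combine j (fromℕ n')

  power-split : r * K * 2 ≡ 2 ^ n
  power-split = trans (cong (_* 2) (sym (^-distribˡ-+-* 2 k m)))
    (trans (*-comm (2 ^ (k + m)) 2) (cong (2 ^_) (trans (cong suc (+-comm k m)) dim)))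

  -- A pair `(x , d)` is the half-edge at `x` in direction `d`. Each step owns two of them, told
  -- apart by the Boolean, and there are `2 ^ n * n` in all.
  stepEnd : (Fin r × Fin N) × Bool → Vertex n × Fin n
  stepEnd ((i , t) , b) = (if b then flip (ℓ i t) (C i t) else C i t) , ℓ i t

  stepEnd-surjective : ∀ y → ∃[ p ] stepEnd p ≡ y
  stepEnd-surjective (x , d) with traversed x d
  ... | i , t , refl , inj₁ refl = ((i , t) , false) , refl
  ... | i , t , refl , inj₂ refl = ((i , t) , true) , refl

  stepEnd-injective : ∀ {p q} → stepEnd p ≡ stepEnd q → p ≡ q
  stepEnd-injective = surjective⇒injective
    (↔-sym *↔× ↔-∘ (↔-sym *↔× ×-↔ ↔-sym 2↔Bool)) (↔-sym *↔× ↔-∘ (Vertex↔Fin n ×-↔ ↔-id _)) count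
    stepEnd stepEnd-surjective
    where
    count : r * N * 2 ≡ 2 ^ n * n
    count = trans (cong (_* 2) (sym (*-assoc r K n)))
      (trans (*-assoc (r * K) n 2) (trans (cong (r * K *_) (*-comm n 2))
      (trans (sym (*-assoc (r * K) 2 n)) (cong (_* n) power-split))))

  matchEnd : (Fin r × Fin K) × Bool → Vertex n
  matchEnd ((i , j) , b) = if b then C i (next (lastOf j)) else C i (lastOf j)

  matchEnd-surjective : ∀ x → ∃[ p ] matchEnd p ≡ x
  matchEnd-surjective x with matched x
  ... | i , j , inj₁ e = ((i , j) , false) , e
  ... | i , j , inj₂ e = ((i , j) , true) , e

  matchEnd-injective : ∀ {p q} → matchEnd p ≡ matchEnd q → p ≡ q
  matchEnd-injective = surjective⇒injective
    (↔-sym *↔× ↔-∘ (↔-sym *↔× ×-↔ ↔-sym 2↔Bool)) (Vertex↔Fin n) power-split matchEnd matchEnd-surjective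

  cycEdge-injective : ∀ i i' t t' → SameEdge (cycEdge (C i) t) (cycEdge (C i') t') → (i , t) ≡ (i' , t')
  cycEdge-injective i i' t t' (inj₁ (p , q)) =
    cong proj₁ (stepEnd-injective {(i , t) , false} {(i' , t') , false}
      (cong₂ _,_ p (flip-injective-letter (C i t)
        (trans (sym (step i t)) (trans q (trans (step i' t') (cong (flip (ℓ i' t')) (sym p))))))))
  -- Opposite traversal: the near half-edge of one step is the far half-edge of the other. The
  -- equality so obtained also contains `false ≡ true`, which shows that this case never occurs; its
  -- first component already gives the claim.
  cycEdge-injective i i' t t' (inj₂ (p , q)) =
    cong proj₁ (stepEnd-injective {(i , t) , false} {(i' , t') , true} (cong₂ _,_ p' (flip-injective-letter (C i t) same)))
    where
    p' : C i t ≡ flip (ℓ i' t') (C i' t')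
    p' = trans p (step i' t')
    same : flip (ℓ i t) (C i t) ≡ flip (ℓ i' t') (C i t)
    same = trans (sym (step i t)) (trans q (sym (trans (cong (flip (ℓ i' t')) p') (flip-involutive (ℓ i' t') (C i' t')))))

  cycle : ∀ i → IsCycle N (C i)
  cycle i = ≤-trans (n≤1+n 3) (*-mono-≤ 2≤K (s≤s 1≤n')) , (λ _ _ → injective i) ,
    λ t → subst (Adjacent (C i t)) (sym (step i t)) (adjacent-flip (ℓ i t) (C i t))

  decomposition : IsCycleDecomposition n r N C
  decomposition = cycle , covers , λ i i' t t' e → cong proj₁ (cycEdge-injective i i' t t' e)
    where
    covers : ∀ u v → Adjacent u v → ∃[ i ] ∃[ t ] SameEdge (cycEdge (C i) t) (u , v)
    covers u v adj with adjacent⇒flip {u = u} {v} adj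
    ... | d , refl with traversed u d
    ...   | i , t , refl , inj₁ refl = i , t , inj₁ (refl , step i t)
    ...   | i , t , refl , inj₂ refl = i , t , inj₂ (sym (flip-involutive (ℓ i t) _) , step i t)

  chosen : Fin r → Fin K → Edge n
  chosen i j = cycEdge (C i) (lastOf j)

  next-combine : ∀ (a : Fin K) (s s' : Fin n) → Consecutive s s' → next (combine a s) ≡ combine a s'
  next-combine a s s' cons = toℕ-injective (helper (toℕ-next (combine a s)))
    where
    target : toℕ (combine a s') ≡ suc (toℕ (combine a s))
    target = trans (toℕ-combine a s') (trans (cong (n * toℕ a +_) cons) (trans (+-suc _ _) (cong suc (sym (toℕ-combine a s)))))
    helper : _ → toℕ (next (combine a s)) ≡ toℕ (combine a s')
    helper (inj₁ (_ , e)) = trans e (sym target)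
    helper (inj₂ (e , _)) = contradiction (subst (_< N) (trans target e) (toℕ<n (combine a s'))) (<-irrefl refl)

  -- The cycle is divided into `K` runs of `n` consecutive vertices, and the chosen edges are those
  -- leading from one run to the next. Removing them leaves the runs as paths.
  propertyI : ∀ i → PropertyI (C i) (chosen i) n
  propertyI i = (λ j → lastOf j , inj₁ (refl , refl)) , distinct ,
      (λ a s → C i (combine a s)) ,
      (λ a s s' e → proj₂ (combine-injective a s a s' (injective i e))) ,
      (λ a a' s s' e → proj₁ (combine-injective a s a' s' (injective i e))) ,
      (λ v → mk⇔ (λ (t , e) → let (a , s , p) = position t in a , s , trans (cong (C i) p) e)
                 (λ (a , s , e) → combine a s , e)) ,
      λ x → mk⇔ (uncut x) (cut x)
    where
    position : ∀ t → ∃[ a ] ∃[ s ] combine a s ≡ t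
    position t = _ , _ , combine-remQuot {K} n t
    chosen-index : ∀ {t j} → SameEdge (chosen i j) (cycEdge (C i) t) → lastOf j ≡ t
    chosen-index e = cong proj₂ (cycEdge-injective i i _ _ e)
    distinct : ∀ j j' → SameEdge (chosen i j) (chosen i j') → j ≡ j'
    distinct j j' e = proj₁ (combine-injective j (fromℕ n') j' (fromℕ n') (chosen-index e))
    uncut : ∀ x → RemEdge (C i) (chosen i) x →
      ∃[ a ] ∃[ s ] ∃[ s' ] (Consecutive s s' × SameEdge (C i (combine a s) , C i (combine a s')) x)
    uncut x ((t , e) , not-chosen) with position t
    ... | a , s , refl with m≤n⇒m<n∨m≡n (toℕ<n s)
    ...   | inj₁ lt = a , s , fromℕ< lt , toℕ-fromℕ< lt ,
              subst (λ t' → SameEdge (C i (combine a s) , C i t') x) (next-combine a s _ (toℕ-fromℕ< lt)) e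
    ...   | inj₂ eq = contradiction (a , subst (λ s → SameEdge (cycEdge (C i) (combine a s)) x)
              (toℕ-injective (trans (suc-injective eq) (sym (toℕ-fromℕ n')))) e) not-chosen
    cut : ∀ x → ∃[ a ] ∃[ s ] ∃[ s' ] (Consecutive s s' × SameEdge (C i (combine a s) , C i (combine a s')) x) →
      RemEdge (C i) (chosen i) x
    cut x (a , s , s' , cons , e) = (combine a s , e') , λ (j , f) → not-last
        (proj₂ (combine-injective j (fromℕ n') a s (chosen-index (sameEdge-trans f (sameEdge-sym e')))))
      where
      e' : SameEdge (cycEdge (C i) (combine a s)) x
      e' = subst (λ t' → SameEdge (C i (combine a s) , C i t') x) (sym (next-combine a s s' cons)) e
      not-last : fromℕ n' ≢ s
      not-last refl = <-irrefl (trans cons (cong suc (toℕ-fromℕ n'))) (toℕ<n s')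

  perfectMatching : IsPerfectMatching n r K chosen
  perfectMatching = (λ i j → proj₂ (proj₂ (cycle i)) (lastOf j)) , covered , same
    where
    covered : ∀ v → ∃[ i ] ∃[ j ] Endpoint v (chosen i j)
    covered v with matched v
    ... | i , j , inj₁ e = i , j , inj₁ (sym e)
    ... | i , j , inj₂ e = i , j , inj₂ (sym e)
    end : ∀ {v i j} → Endpoint v (chosen i j) → ∃[ b ] v ≡ matchEnd ((i , j) , b)
    end (inj₁ e) = false , e
    end (inj₂ e) = true , e
    same : ∀ v i j i' j' → Endpoint v (chosen i j) → Endpoint v (chosen i' j') → SameEdge (chosen i j) (chosen i' j')
    same v i j i' j' e e' with end {i = i} {j} e | end {i = i'} {j'} e'
    ... | b , p | b' , p' with matchEnd-injective {(i , j) , b} {(i' , j') , b'} (trans (sym p) p')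
    ...   | refl = inj₁ (refl , refl)

  decomposes : Decomposes m n k
  decomposes = C , chosen , decomposition , propertyI , perfectMatching

-- Linear quotients of the cube

flip-comm : ∀ {n} (d e : Fin n) x → flip d (flip e x) ≡ flip e (flip d x)
flip-comm d e x with d Fin.≟ e
... | yes refl = refl
... | no d≢e = updateAt-commutes d e d≢e x

flipIf : ∀ {n} → Bool → Fin n → Vertex n → Vertex n
flipIf b a x = if b then flip a x else x

flipIf-flip : ∀ {n} b (a d : Fin n) x → flipIf b a (flip d x) ≡ flip d (flipIf b a x)
flipIf-flip false a d x = refl
flipIf-flip true a d x = flip-comm a d x

-- A linear quotient F₂ⁿ → F₂^q without the linear algebra: the kernel F₂^k acts by translations τ.
record Quotient (n q k : ℕ) : Set where
  field
    dim : q + k ≡ n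
    φ : Vertex n → Vertex q
    τ : Vertex k → Vertex n → Vertex n
    τ-flip : ∀ i d x → τ i (flip d x) ≡ flip d (τ i x)
    τ-involutive : ∀ i x → τ i (τ i x) ≡ x
    transitive : ∀ x y → φ x ≡ φ y → ∃[ i ] τ i x ≡ y

trivialQuotient : Quotient 0 0 0
trivialQuotient = record
  { dim = refl
  ; φ = id
  ; τ = λ _ → id
  ; τ-flip = λ _ ()
  ; τ-involutive = λ _ _ → refl
  ; transitive = λ { [] [] _ → [] , refl }
  }

-- The label of the new direction `0` is a new basis vector, so the kernel does not grow.
addIndependent : ∀ {n q k} → Quotient n q k → Quotient (suc n) (suc q) k
addIndependent {n} {q} {k} Q = record
  { dim = cong suc dim
  ; φ = φ'
  ; τ = τ'
  ; τ-flip = λ { i zero (b ∷ x) → refl ; i (suc d) (b ∷ x) → cong (b ∷_) (τ-flip i d x) }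
  ; τ-involutive = λ { i (b ∷ x) → cong (b ∷_) (τ-involutive i x) }
  ; transitive = transitive'
  }
  where
  open Quotient Q
  φ' : Vertex (suc n) → Vertex (suc q)
  φ' (b ∷ x) = b ∷ φ x
  τ' : Vertex k → Vertex (suc n) → Vertex (suc n)
  τ' i (b ∷ x) = b ∷ τ i x
  transitive' : ∀ x y → φ' x ≡ φ' y → ∃[ i ] τ' i x ≡ y
  transitive' (b ∷ x) (c ∷ y) e with ∷-injective e
  ... | refl , e' = let (i , p) = transitive x y e' in i , cong (b ∷_) p

-- The new direction `0` gets the label of `a`. The kernel gains the vector that changes both
-- coordinates, and the new bit `c` of the index says whether to translate by it.
addDependent : ∀ {n q k} → Fin n → Quotient n q k → Quotient (suc n) q (suc k)
addDependent {n} {q} {k} a Q = record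
  { dim = trans (+-suc _ _) (cong suc dim)
  ; φ = φ'
  ; τ = τ'
  ; τ-flip = λ { (c ∷ i) zero (b ∷ x) → cong (_∷ τ i (flipIf c a x)) (sym (not-distribʳ-xor c b))
               ; (c ∷ i) (suc d) (b ∷ x) → cong ((c xor b) ∷_) (trans (cong (τ i) (flipIf-flip c a d x)) (τ-flip i d _)) }
  ; τ-involutive = λ { (c ∷ i) (b ∷ x) → cong₂ _∷_ (xor-cancelˡ c b)
      (trans (cong (τ i) (trans (sym (τ-flipIf i c _)) (cong (τ i) (flipIf-involutive c x)))) (τ-involutive i x)) }
  ; transitive = transitive'
  }
  where
  open Quotient Q
  φ' : Vertex (suc n) → Vertex q
  φ' (b ∷ x) = φ (flipIf b a x)
  τ' : Vertex (suc k) → Vertex (suc n) → Vertex (suc n)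
  τ' (c ∷ i) (b ∷ x) = (c xor b) ∷ τ i (flipIf c a x)
  τ-flipIf : ∀ i b x → τ i (flipIf b a x) ≡ flipIf b a (τ i x)
  τ-flipIf i false x = refl
  τ-flipIf i true x = τ-flip i a x
  flipIf-involutive : ∀ b x → flipIf b a (flipIf b a x) ≡ x
  flipIf-involutive false x = refl
  flipIf-involutive true x = flip-involutive a x
  xor-cancelˡ : ∀ b c → b xor (b xor c) ≡ c
  xor-cancelˡ false c = refl
  xor-cancelˡ true c = not-involutive c
  xor-cancelʳ : ∀ b c → (b xor c) xor c ≡ b
  xor-cancelʳ b c = trans (xor-comm _ c) (trans (cong (c xor_) (xor-comm b c)) (xor-cancelˡ c b))
  flipIf-xor : ∀ b c x → flipIf (b xor c) a x ≡ flipIf b a (flipIf c a x)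
  flipIf-xor false c x = refl
  flipIf-xor true false x = refl
  flipIf-xor true true x = sym (flip-involutive a x)
  transitive' : ∀ x y → φ' x ≡ φ' y → ∃[ i ] τ' i x ≡ y
  transitive' (b ∷ x) (c ∷ y) e with transitive (flipIf b a x) (flipIf c a y) e
  ... | i , p = (c xor b) ∷ i , cong₂ _∷_ (xor-cancelʳ c b)
    (trans (cong (τ i) (flipIf-xor c b x)) (trans (τ-flipIf i c _) (trans (cong (flipIf c a) p) (flipIf-involutive c y))))

-- Words and the walks they trace

origin : ∀ {n} → Vertex n
origin = replicate _ false

run : ∀ {n} → List (Fin n) → Vertex n → Vertex n
run [] x = x
run (d ∷ w) x = run w (flip d x)

visits : ∀ {n} → List (Fin n) → Vertex n → List (Vertex n)
visits [] x = []
visits (d ∷ w) x = x ∷ visits w (flip d x)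

steps : ∀ {n} → List (Fin n) → Vertex n → List (Vertex n × Fin n)
steps [] x = []
steps (d ∷ w) x = (x , d) ∷ steps w (flip d x)

run-++ : ∀ {n} (u w : List (Fin n)) x → run (u ++ w) x ≡ run w (run u x)
run-++ [] w x = refl
run-++ (d ∷ u) w x = run-++ u w (flip d x)

visits-++ : ∀ {n} (u w : List (Fin n)) x → visits (u ++ w) x ≡ visits u x ++ visits w (run u x)
visits-++ [] w x = refl
visits-++ (d ∷ u) w x = cong (x ∷_) (visits-++ u w (flip d x))

steps-++ : ∀ {n} (u w : List (Fin n)) x → steps (u ++ w) x ≡ steps u x ++ steps w (run u x)
steps-++ [] w x = refl
steps-++ (d ∷ u) w x = cong ((x , d) ∷_) (steps-++ u w (flip d x))

step-letter : ∀ {n} {x} {d} (w : List (Fin n)) x₀ → (x , d) ∈ steps w x₀ → d ∈ w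
step-letter (d ∷ w) x₀ (here refl) = here refl
step-letter (d ∷ w) x₀ (there s) = there (step-letter w (flip d x₀) s)

vertexAt : ∀ {n} → List (Fin n) → Vertex n → ℕ → Vertex n
vertexAt w x zero = x
vertexAt [] x (suc t) = x
vertexAt (d ∷ w) x (suc t) = vertexAt w (flip d x) t

letterAt : ∀ {n} → Fin n → List (Fin n) → ℕ → Fin n
letterAt z [] t = z
letterAt z (d ∷ w) zero = d
letterAt z (d ∷ w) (suc t) = letterAt z w t

vertexAt-suc : ∀ {n} z (w : List (Fin n)) x t → t < length w →
  vertexAt w x (suc t) ≡ flip (letterAt z w t) (vertexAt w x t)
vertexAt-suc z (d ∷ w) x zero lt = refl
vertexAt-suc z (d ∷ w) x (suc t) (s≤s lt) = vertexAt-suc z w (flip d x) t lt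

vertexAt-length : ∀ {n} (w : List (Fin n)) x → vertexAt w x (length w) ≡ run w x
vertexAt-length [] x = refl
vertexAt-length (d ∷ w) x = vertexAt-length w (flip d x)

vertexAt-++ : ∀ {n} (u w : List (Fin n)) x t → vertexAt (u ++ w) x (length u + t) ≡ vertexAt w (run u x) t
vertexAt-++ [] w x t = refl
vertexAt-++ (d ∷ u) w x t = vertexAt-++ u w (flip d x) t

letterAt-++ : ∀ {n} z (u w : List (Fin n)) t → letterAt z (u ++ w) (length u + t) ≡ letterAt z w t
letterAt-++ z [] w t = refl
letterAt-++ z (d ∷ u) w t = letterAt-++ z u w t

vertexAt-visits : ∀ {n} (w : List (Fin n)) x t → t < length w → vertexAt w x t ∈ visits w x
vertexAt-visits (d ∷ w) x zero lt = here refl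
vertexAt-visits (d ∷ w) x (suc t) (s≤s lt) = there (vertexAt-visits w (flip d x) t lt)

vertexAt-injective : ∀ {n} (w : List (Fin n)) x → Unique (visits w x) → ∀ s t → s < length w → t < length w →
  vertexAt w x s ≡ vertexAt w x t → s ≡ t
vertexAt-injective (d ∷ w) x u zero zero _ _ e = refl
vertexAt-injective (d ∷ w) x (x∉ ∷ u) zero (suc t) _ (s≤s lt) e = contradiction e (All.lookup x∉ (vertexAt-visits w _ t lt))
vertexAt-injective (d ∷ w) x (x∉ ∷ u) (suc s) zero (s≤s ls) _ e = contradiction (sym e) (All.lookup x∉ (vertexAt-visits w _ s ls))
vertexAt-injective (d ∷ w) x (x∉ ∷ u) (suc s) (suc t) (s≤s ls) (s≤s lt) e =
  cong suc (vertexAt-injective w (flip d x) u s t ls lt e)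

steps-position : ∀ {n} z (w : List (Fin n)) x₀ {x d} → (x , d) ∈ steps w x₀ →
  ∃[ t ] (t < length w × vertexAt w x₀ t ≡ x × letterAt z w t ≡ d)
steps-position z (d ∷ w) x₀ (here refl) = 0 , s≤s z≤n , refl , refl
steps-position z (d ∷ w) x₀ (there s) with steps-position z w (flip d x₀) s
... | t , lt , p , q = suc t , s≤s lt , p , q

-- Words cut into blocks by the matched letter, and their translates

joinBlocks : ∀ {n} → Fin n → List (List (Fin n)) → List (Fin n)
joinBlocks z [] = []
joinBlocks z (X ∷ Xs) = X ++ z ∷ joinBlocks z Xs

joinBlocks-length : ∀ {n} (z : Fin n) Xs → All (λ X → suc (length X) ≡ n) Xs → length (joinBlocks z Xs) ≡ length Xs * n
joinBlocks-length z [] [] = refl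
joinBlocks-length {n} z (X ∷ Xs) (p ∷ ps) =
  trans (length-++ X) (trans (+-suc (length X) _) (cong₂ _+_ p (joinBlocks-length z Xs ps)))

-- Blocks avoid `z`, so a step in direction `z` is one of the separators, and the separator behind
-- block `j` has position `n * j + (n - 1)`, which is the last place of the `j`-th run of length
-- `n`.
joinBlocks-position : ∀ {n'} (z : Fin (suc n')) Xs x₀ {x} →
  All (λ X → suc (length X) ≡ suc n') Xs → All (All (_≢ z)) Xs → (x , z) ∈ steps (joinBlocks z Xs) x₀ →
  ∃[ j ] (j < length Xs × vertexAt (joinBlocks z Xs) x₀ (suc n' * j + n') ≡ x
                        × letterAt z (joinBlocks z Xs) (suc n' * j + n') ≡ z)
joinBlocks-position {n'} z (X ∷ Xs) x₀ (size ∷ ps) (a ∷ as) s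
  with ∈-++⁻ (steps X x₀) (subst (_ ∈_) (steps-++ X (z ∷ joinBlocks z Xs) x₀) s)
... | inj₁ s' = contradiction refl (All.lookup a (step-letter X x₀ s'))
... | inj₂ (here refl) = 0 , s≤s z≤n ,
        trans (cong (vertexAt w x₀) first) (vertexAt-++ X _ x₀ 0) ,
        trans (cong (letterAt z w) first) (letterAt-++ z X _ 0)
  where
  w = joinBlocks z (X ∷ Xs)
  first : suc n' * 0 + n' ≡ length X + 0
  first = trans (cong (_+ n') (*-zeroʳ (suc n'))) (trans (sym (suc-injective size)) (sym (+-identityʳ _)))
... | inj₂ (there s') with joinBlocks-position z Xs _ ps as s'
...   | j , lt , p , q = suc j , s≤s lt ,
        trans (cong (vertexAt w x₀) later) (trans (vertexAt-++ X _ x₀ _) p) ,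
        trans (cong (letterAt z w) later) (trans (letterAt-++ z X _ _) q)
  where
  w = joinBlocks z (X ∷ Xs)
  later : suc n' * suc j + n' ≡ length X + suc (suc n' * j + n')
  later = trans (cong (_+ n') (*-suc (suc n') j)) (trans (+-assoc (suc n') _ n')
    (trans (sym (+-suc n' _)) (cong (_+ suc (suc n' * j + n')) (sym (suc-injective size)))))

record Trail {n q} (φ : Vertex n → Vertex q) (K : ℕ) : Set where
  field
    z : Fin n
    blocks : List (List (Fin n))
    blockCount : length blocks ≡ K
    sizes : All (λ X → suc (length X) ≡ n) blocks
    avoids : All (All (_≢ z)) blocks

  word : List (Fin n)
  word = joinBlocks z blocks

  field
    closed : run word origin ≡ origin
    simple : Unique (visits word origin)
    euler : ∀ r d → ∃[ x ] ((x , d) ∈ steps word origin × (φ x ≡ r ⊎ φ (flip d x) ≡ r))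

-- The circuit has a step in direction `d` with an end over `φ x`. By `transitive` a translation
-- moves that end to `x`, and since translations commute with flips the step keeps its direction.
-- Applied to the matched letter, this gives the matching.
trail⇒decomposes : ∀ {m n' k} → 1 ≤ m → 1 ≤ n' → (Q : Quotient (suc n') (suc m) k) →
  Trail (Quotient.φ Q) (2 ^ m) → Decomposes m (suc n') k
trail⇒decomposes {m} {n'} {k} 1≤m 1≤n' Q T =
  Assembly.decomposes m n' k 1≤m 1≤n' dim C ℓ step injective traversed matched
  where
  open Quotient Q
  open Trail T
  open Inverse (Vertex↔Fin k) using (to; from; strictlyInverseʳ)
  n = suc n'
  N = 2 ^ m * n
  word-length : length word ≡ N
  word-length = trans (joinBlocks-length z blocks sizes) (cong (_* n) blockCount)
  c = vertexAt word origin
  C : Fin (2 ^ k) → Fin N → Vertex n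
  C i t = τ (from i) (c (toℕ t))
  ℓ : Fin (2 ^ k) → Fin N → Fin n
  ℓ i t = letterAt z word (toℕ t)
  below : (t : Fin N) → toℕ t < length word
  below t = subst (toℕ t <_) (sym word-length) (toℕ<n t)
  c-next : ∀ t → c (toℕ (next t)) ≡ c (suc (toℕ t))
  c-next t with toℕ-next t
  ... | inj₁ (_ , e) = cong c e
  ... | inj₂ (e , e') = trans (cong c e') (sym (trans (cong c (trans e (sym word-length)))
          (trans (vertexAt-length word origin) closed)))
  step : ∀ i t → C i (next t) ≡ flip (ℓ i t) (C i t)
  step i t = trans (cong (τ (from i)) (trans (c-next t) (vertexAt-suc z word origin _ (below t)))) (τ-flip (from i) _ _)
  τ-injective : ∀ i {x y} → τ i x ≡ τ i y → x ≡ y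
  τ-injective i {x} {y} e = trans (sym (τ-involutive i x)) (trans (cong (τ i) e) (τ-involutive i y))
  injective : ∀ i {s t} → C i s ≡ C i t → s ≡ t
  injective i {s} {t} e = toℕ-injective (vertexAt-injective word origin simple _ _ (below s) (below t) (τ-injective (from i) e))
  C-to : ∀ i t {x y} → c (toℕ t) ≡ x → τ i x ≡ y → C (to i) t ≡ y
  C-to i t refl e = trans (cong (λ i → τ i (c (toℕ t))) (strictlyInverseʳ i)) e
  traversed : ∀ x d → ∃[ i ] ∃[ t ] (ℓ i t ≡ d × (C i t ≡ x ⊎ flip d (C i t) ≡ x))
  traversed x d with euler (φ x) d
  ... | y , s , e with steps-position z word origin s
  ...   | t , lt , refl , q = found e
    where
    t' : Fin N
    t' = fromℕ< (subst (t <_) word-length lt)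
    t≡ : toℕ t' ≡ t
    t≡ = toℕ-fromℕ< _
    found : φ y ≡ φ x ⊎ φ (flip d y) ≡ φ x → ∃[ i ] ∃[ t ] (ℓ i t ≡ d × (C i t ≡ x ⊎ flip d (C i t) ≡ x))
    found (inj₁ e) = let (i , p) = transitive y x e in
      to i , t' , trans (cong (letterAt z word) t≡) q , inj₁ (C-to i t' (cong c t≡) p)
    found (inj₂ e) = let (i , p) = transitive (flip d y) x e in
      to i , t' , trans (cong (letterAt z word) t≡) q ,
      inj₂ (trans (cong (flip d) (C-to i t' (cong c t≡) refl)) (trans (sym (τ-flip i d y)) p))
  matched : ∀ x → ∃[ i ] ∃[ j ] (C i (combine j (fromℕ n')) ≡ x ⊎ C i (next (combine j (fromℕ n'))) ≡ x)
  matched x with euler (φ x) z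
  ... | y , s , e with joinBlocks-position z blocks origin sizes avoids s
  ...   | j , lt , p , q = found e
    where
    j' : Fin (2 ^ m)
    j' = fromℕ< (subst (j <_) blockCount lt)
    t : Fin N
    t = combine j' (fromℕ n')
    t≡ : toℕ t ≡ n * j + n'
    t≡ = trans (toℕ-combine j' (fromℕ n')) (cong₂ (λ j n' → n * j + n') (toℕ-fromℕ< _) (toℕ-fromℕ n'))
    found : φ y ≡ φ x ⊎ φ (flip z y) ≡ φ x →
      ∃[ i ] ∃[ j ] (C i (combine j (fromℕ n')) ≡ x ⊎ C i (next (combine j (fromℕ n'))) ≡ x)
    found (inj₁ e) = let (i , e') = transitive y x e in to i , j' , inj₁ (C-to i t (trans (cong c t≡) p) e')
    found (inj₂ e) = let (i , e') = transitive (flip z y) x e in to i , j' ,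
      inj₂ (trans (step (to i) t)
           (trans (cong₂ flip (trans (cong (letterAt z word) t≡) q) (C-to i t (trans (cong c t≡) p) refl))
           (trans (sym (τ-flip i z y)) e')))

-- Inserting new letters into a word

parity : ∀ {k} → Vertex k → Bool
parity = foldr′ _xor_ false

parity-flip : ∀ {k} (e : Fin k) p → parity (flip e p) ≡ not (parity p)
parity-flip zero (false ∷ p) = refl
parity-flip zero (true ∷ p) = sym (not-involutive _)
parity-flip (suc e) (false ∷ p) = parity-flip e p
parity-flip (suc e) (true ∷ p) = cong not (parity-flip e p)

flip-++ˡ : ∀ {k n} (e : Fin k) (p : Vertex k) (x : Vertex n) → flip (e ↑ˡ n) (p ++ᵛ x) ≡ flip e p ++ᵛ x
flip-++ˡ zero (a ∷ p) x = refl
flip-++ˡ (suc e) (a ∷ p) x = cong (a ∷_) (flip-++ˡ e p x)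

flip-++ʳ : ∀ {k n} (d : Fin n) (p : Vertex k) (x : Vertex n) → flip (k ↑ʳ d) (p ++ᵛ x) ≡ p ++ᵛ flip d x
flip-++ʳ d [] x = refl
flip-++ʳ d (a ∷ p) x = cong (a ∷_) (flip-++ʳ d p x)

-- A word over Fin n together with the new letters inserted in front of each of its letters.
Dressing : ℕ → ℕ → Set
Dressing k n = List (List (Fin k) × Fin n)

expand : ∀ {k n} → Dressing k n → List (Fin (k + n))
expand [] = []
expand {k} {n} ((i , d) ∷ ts) = map (_↑ˡ n) i ++ (k ↑ʳ d) ∷ expand ts

bare : ∀ {k n} → Dressing k n → List (Fin n)
bare = map proj₂

sites : ∀ {k n} → Dressing k n → Vertex n → List (Vertex n × List (Fin k))
sites [] x = []
sites ((i , d) ∷ ts) x = (x , i) ∷ sites ts (flip d x)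

-- The last point is included, because the old letter behind the insertion departs from it. These
-- are all the points visited over one old vertex in one pass.
trace : ∀ {k} → List (Fin k) → Vertex k → List (Vertex k)
trace [] p = p ∷ []
trace (e ∷ i) p = p ∷ trace i (flip e p)

run-inserted : ∀ {k n} (i : List (Fin k)) p (x : Vertex n) → run (map (_↑ˡ n) i) (p ++ᵛ x) ≡ run i p ++ᵛ x
run-inserted [] p x = refl
run-inserted {n = n} (e ∷ i) p x = trans (cong (run (map (_↑ˡ n) i)) (flip-++ˡ e p x)) (run-inserted i (flip e p) x)

visits-expand : ∀ {k n} (i : List (Fin k)) (d : Fin n) ts p x →
  visits (expand ((i , d) ∷ ts)) (p ++ᵛ x) ≡ map (_++ᵛ x) (trace i p) ++ visits (expand ts) (run i p ++ᵛ flip d x)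
visits-expand [] d ts p x = cong (λ y → (p ++ᵛ x) ∷ visits (expand ts) y) (flip-++ʳ d p x)
visits-expand {n = n} (e ∷ i) d ts p x = cong ((p ++ᵛ x) ∷_)
  (trans (cong (visits (expand ((i , d) ∷ ts))) (flip-++ˡ e p x)) (visits-expand i d ts (flip e p) x))

steps-expand : ∀ {k n} (i : List (Fin k)) (d : Fin n) ts p x →
  steps (expand ((i , d) ∷ ts)) (p ++ᵛ x) ≡
  steps (map (_↑ˡ n) i) (p ++ᵛ x) ++ (run i p ++ᵛ x , k ↑ʳ d) ∷ steps (expand ts) (run i p ++ᵛ flip d x)
steps-expand {k} {n} i d ts p x = trans (steps-++ (map (_↑ˡ n) i) _ (p ++ᵛ x)) (cong (steps (map (_↑ˡ n) i) (p ++ᵛ x) ++_)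
  (trans (cong (λ y → (y , k ↑ʳ d) ∷ steps (expand ts) (flip (k ↑ʳ d) y)) (run-inserted i p x))
         (cong (λ y → (run i p ++ᵛ x , k ↑ʳ d) ∷ steps (expand ts) y) (flip-++ʳ d (run i p) x))))

run-expand : ∀ {k n} (i : List (Fin k)) (d : Fin n) ts p x →
  run (expand ((i , d) ∷ ts)) (p ++ᵛ x) ≡ run (expand ts) (run i p ++ᵛ flip d x)
run-expand i d ts p x = trans (run-++ (map (_↑ˡ _) i) _ (p ++ᵛ x))
  (cong (run (expand ts)) (trans (cong (flip _) (run-inserted i p x)) (flip-++ʳ d (run i p) x)))

inserted-step : ∀ {k n} (ts : Dressing k n) p₀ x₀ {x i e} → (x , i) ∈ sites ts x₀ → e ∈ i →
  ∃[ p ] (p ++ᵛ x , e ↑ˡ n) ∈ steps (expand ts) (p₀ ++ᵛ x₀)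
inserted-step ((i , d) ∷ ts) p₀ x₀ (there s) e∈i with inserted-step ts (run i p₀) (flip d x₀) s e∈i
... | p , s' = p , subst (_ ∈_) (sym (steps-expand i d ts p₀ x₀)) (∈-++⁺ʳ (steps (map (_↑ˡ _) i) _) (there s'))
inserted-step {n = n} ((i , d) ∷ ts) p₀ x₀ (here refl) e∈i with within i p₀ e∈i
  where
  within : ∀ i p {e} → e ∈ i → ∃[ p' ] (p' ++ᵛ x₀ , e ↑ˡ n) ∈ steps (map (_↑ˡ n) i) (p ++ᵛ x₀)
  within (e ∷ i) p (here refl) = p , here refl
  within (e ∷ i) p (there e∈i) with within i (flip e p) e∈i
  ... | p' , s = p' , there (subst (λ y → _ ∈ steps (map (_↑ˡ n) i) y) (sym (flip-++ˡ e p x₀)) s)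
... | p , s = p , subst (_ ∈_) (sym (steps-expand i d ts p₀ x₀)) (∈-++⁺ˡ s)

Over : ∀ {k n} → List (Vertex n) → Vertex (k + n) → Set
Over {k} {n} V v = Σ (Vertex k) λ p → ∃[ x ] (v ≡ p ++ᵛ x × x ∈ V)

visits-over : ∀ {k n} (ts : Dressing k n) p x {v} → v ∈ visits (expand ts) (p ++ᵛ x) → Over {k} (visits (bare ts) x) v
visits-over ((i , d) ∷ ts) p x v∈ with ∈-++⁻ (map (_++ᵛ x) (trace i p)) (subst (_ ∈_) (visits-expand i d ts p x) v∈)
... | inj₁ v∈' with ∈-map⁻ (_++ᵛ x) v∈'
...   | q , _ , refl = q , x , refl , here refl
visits-over ((i , d) ∷ ts) p x v∈ | inj₂ v∈' with visits-over ts (run i p) (flip d x) v∈'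
... | q , y , e , y∈ = q , y , e , there y∈

-- The old coordinates tell the points over `x` from those over `V`. Hence a dressed walk over a
-- simple one can repeat a vertex only within the fibre over a single old vertex.
unique-over : ∀ {k n} {V : List (Vertex n)} {x} (L : List (Vertex k)) {R} → All (x ≢_) V → Unique L → Unique R →
  (∀ {v} → v ∈ R → Over {k} V v) → Unique (map (_++ᵛ x) L ++ R)
unique-over {x = x} L x∉V uL uR over = Uniqueₚ.++⁺ (Uniqueₚ.map⁺ (λ {p} {q} → ++-injectiveˡ p q) uL) uR disjoint
  where
  disjoint : ∀ {v} → ¬ (v ∈ map (_++ᵛ x) L × v ∈ _)
  disjoint (v∈L , v∈R) with ∈-map⁻ (_++ᵛ x) v∈L | over v∈R
  ... | p , _ , e | q , y , e' , y∈V = All.lookup x∉V y∈V (++-injectiveʳ p q (trans (sym e) e'))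

unique-resp-↭ : ∀ {A : Set} {xs ys : List A} → xs ↭ ys → Unique xs → Unique ys
unique-resp-↭ {A} p = Permutationₛ.Unique-resp-↭ (setoid A) (↭⇒↭ₛ p)

-- The new coordinates, moving from p to q along the word, never repeat at a place and are even at each old letter.
data Single {k n} : Dressing k n → Vertex k → Vertex k → Set where
  []  : ∀ {p} → Single [] p p
  add : ∀ {i d ts p q} → Unique (trace i p) → parity (run i p) ≡ false → Single ts (run i p) q → Single ((i , d) ∷ ts) p q

single-run : ∀ {k n} {ts : Dressing k n} {p q} → Single ts p q → ∀ x → run (expand ts) (p ++ᵛ x) ≡ q ++ᵛ run (bare ts) x
single-run [] x = refl
single-run (add {i} {d} {ts} {p} _ _ S) x = trans (run-expand i d ts p x) (single-run S (flip d x))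

single-simple : ∀ {k n} {ts : Dressing k n} {p q} → Single ts p q → ∀ x → Unique (visits (bare ts) x) →
  Unique (visits (expand ts) (p ++ᵛ x))
single-simple [] x u = []
single-simple (add {i} {d} {ts} {p} t _ S) x (x∉ ∷ u) = subst Unique (sym (visits-expand i d ts p x))
  (unique-over (trace i p) x∉ t (single-simple S (flip d x) u) (visits-over ts _ (flip d x)))

single-step : ∀ {k n} {ts : Dressing k n} {p q} → Single ts p q → ∀ x₀ {x d} → (x , d) ∈ steps (bare ts) x₀ →
  ∃[ p' ] (parity p' ≡ false × (p' ++ᵛ x , k ↑ʳ d) ∈ steps (expand ts) (p ++ᵛ x₀))
single-step (add {i} {d} {ts} {p} _ even S) x₀ (here refl) =
  run i p , even , subst (_ ∈_) (sym (steps-expand i d ts p x₀)) (∈-++⁺ʳ (steps (map (_↑ˡ _) i) _) (here refl))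
single-step (add {i} {d} {ts} {p} _ _ S) x₀ (there s) with single-step S (flip d x₀) s
... | p' , even , s' = p' , even , subst (_ ∈_) (sym (steps-expand i d ts p x₀)) (∈-++⁺ʳ (steps (map (_↑ˡ _) i) _) (there s'))

-- Two passes over the same word, with different insertions.
Dressing₂ : ℕ → ℕ → Set
Dressing₂ k n = List ((List (Fin k) × List (Fin k)) × Fin n)

first second : ∀ {k n} → Dressing₂ k n → Dressing k n
first = map λ ((i , j) , d) → i , d
second = map λ ((i , j) , d) → j , d

-- Both passes visit the fibre over each old vertex, so their traces must be jointly free of
-- repetitions. The opposite parities make the two traversals of an old edge lie over different
-- lifts of it. The indices are the starts of the two passes, then their ends.
data Double {k n} : Dressing₂ k n → Vertex k → Vertex k → Vertex k → Vertex k → Set where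
  []  : ∀ {p p'} → Double [] p p' p p'
  add : ∀ {i j d ts p p' q q'} → Unique (trace i p ++ trace j p') → parity (run i p) ≡ not (parity (run j p')) →
        Double ts (run i p) (run j p') q q' → Double (((i , j) , d) ∷ ts) p p' q q'

double-run₁ : ∀ {k n} {ts : Dressing₂ k n} {p p' q q'} → Double ts p p' q q' → ∀ x →
  run (expand (first ts)) (p ++ᵛ x) ≡ q ++ᵛ run (map proj₂ ts) x
double-run₁ [] x = refl
double-run₁ (add {i} {j} {d} {ts} {p} _ _ D) x = trans (run-expand i d (first ts) p x) (double-run₁ D (flip d x))

double-run₂ : ∀ {k n} {ts : Dressing₂ k n} {p p' q q'} → Double ts p p' q q' → ∀ x →
  run (expand (second ts)) (p' ++ᵛ x) ≡ q' ++ᵛ run (map proj₂ ts) x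
double-run₂ [] x = refl
double-run₂ (add {i} {j} {d} {ts} {p} {p'} _ _ D) x = trans (run-expand j d (second ts) p' x) (double-run₂ D (flip d x))

bare-first : ∀ {k n} (ts : Dressing₂ k n) → bare (first ts) ≡ map proj₂ ts
bare-first [] = refl
bare-first (t ∷ ts) = cong (_ ∷_) (bare-first ts)

bare-second : ∀ {k n} (ts : Dressing₂ k n) → bare (second ts) ≡ map proj₂ ts
bare-second [] = refl
bare-second (t ∷ ts) = cong (_ ∷_) (bare-second ts)

double-simple : ∀ {k n} {ts : Dressing₂ k n} {p p' q q'} → Double ts p p' q q' → ∀ x → Unique (visits (map proj₂ ts) x) →
  Unique (visits (expand (first ts)) (p ++ᵛ x) ++ visits (expand (second ts)) (p' ++ᵛ x))
double-simple [] x u = []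
double-simple {k} {n} (add {i} {j} {d} {ts} {p} {p'} t _ D) x (x∉ ∷ u) =
  subst Unique (sym (cong₂ _++_ (visits-expand i d (first ts) p x) (visits-expand j d (second ts) p' x)))
  (unique-resp-↭ regroup (unique-over (trace i p ++ trace j p') x∉ t (double-simple D (flip d x) u) over))
  where
  A = map (_++ᵛ x) (trace i p)
  B = map (_++ᵛ x) (trace j p')
  R = visits (expand (first ts)) (run i p ++ᵛ flip d x)
  S = visits (expand (second ts)) (run j p' ++ᵛ flip d x)
  -- The visits are sorted by old vertex instead of by pass, so that the induction can proceed fibre
  -- by fibre.
  regroup : map (_++ᵛ x) (trace i p ++ trace j p') ++ (R ++ S) ↭ (A ++ R) ++ (B ++ S)
  regroup = ↭-trans (↭-reflexive (trans (cong (_++ (R ++ S)) (map-++ _ (trace i p) (trace j p'))) (++-assoc A B _)))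
    (↭-trans (++⁺ˡ A (shifts B R)) (↭-reflexive (sym (++-assoc A R _))))
  over : ∀ {v} → v ∈ R ++ S → Over {k} (visits (map proj₂ ts) (flip d x)) v
  over v∈ with ∈-++⁻ R v∈
  ... | inj₁ v∈R = subst (λ w → Over {k} (visits w (flip d x)) _) (bare-first ts) (visits-over (first ts) (run i p) (flip d x) v∈R)
  ... | inj₂ v∈S = subst (λ w → Over {k} (visits w (flip d x)) _) (bare-second ts) (visits-over (second ts) (run j p') (flip d x) v∈S)

double-step : ∀ {k n} {ts : Dressing₂ k n} {p p' q q'} → Double ts p p' q q' → ∀ x₀ {x d} → (x , d) ∈ steps (map proj₂ ts) x₀ →
  ∃[ s ] ∃[ s' ] (parity s ≡ not (parity s') × (s ++ᵛ x , k ↑ʳ d) ∈ steps (expand (first ts)) (p ++ᵛ x₀)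
                                           × (s' ++ᵛ x , k ↑ʳ d) ∈ steps (expand (second ts)) (p' ++ᵛ x₀))
double-step (add {i} {j} {d} {ts} {p} {p'} _ opp D) x₀ (here refl) = run i p , run j p' , opp ,
  subst (_ ∈_) (sym (steps-expand i d (first ts) p x₀)) (∈-++⁺ʳ (steps (map (_↑ˡ _) i) _) (here refl)) ,
  subst (_ ∈_) (sym (steps-expand j d (second ts) p' x₀)) (∈-++⁺ʳ (steps (map (_↑ˡ _) j) _) (here refl))
double-step (add {i} {j} {d} {ts} {p} {p'} _ _ D) x₀ (there s) with double-step D (flip d x₀) s
... | t , t' , opp , m , m' = t , t' , opp ,
  subst (_ ∈_) (sym (steps-expand i d (first ts) p x₀)) (∈-++⁺ʳ (steps (map (_↑ˡ _) i) _) (there m)) ,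
  subst (_ ∈_) (sym (steps-expand j d (second ts) p' x₀)) (∈-++⁺ʳ (steps (map (_↑ˡ _) j) _) (there m'))

uniqueVertices? : ∀ {k} (L : List (Vertex k)) → Dec (Unique L)
uniqueVertices? {k} = unique? (≡-dec {n = k} Bool._≟_)

-- From n to n + 2: two letters parallel to the matched one

toggle : ℕ → Bool → Bool
toggle zero b = b
toggle (suc k) b = toggle k (not b)

toggle-+ : ∀ k l b → toggle (k + l) b ≡ toggle l (toggle k b)
toggle-+ zero l b = refl
toggle-+ (suc k) l b = toggle-+ k l (not b)

toggle-not : ∀ k b → toggle k (not b) ≡ not (toggle k b)
toggle-not zero b = refl
toggle-not (suc k) b = toggle-not k (not b)

toggle-double : ∀ k b → toggle (k + k) b ≡ b
toggle-double k b = trans (toggle-+ k k b) (twice k b)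
  where
  twice : ∀ k b → toggle k (toggle k b) ≡ b
  twice zero b = refl
  twice (suc k) b = trans (cong (toggle k) (trans (cong not (toggle-not k b)) (not-involutive _))) (twice k b)

plain : ∀ {k n} → List (Fin n) → Dressing k n
plain = map ([] ,_)

expand-plain : ∀ {k n} (X : List (Fin n)) (ts : Dressing k n) → expand (plain X ++ ts) ≡ map (k ↑ʳ_) X ++ expand ts
expand-plain [] ts = refl
expand-plain {k} (d ∷ X) ts = cong ((k ↑ʳ d) ∷_) (expand-plain X ts)

sites-plain : ∀ {k n} (X : List (Fin n)) (ts : Dressing k n) x₀ {s} → s ∈ sites ts (run X x₀) → s ∈ sites (plain X ++ ts) x₀
sites-plain [] ts x₀ s∈ = s∈
sites-plain (d ∷ X) ts x₀ s∈ = there (sites-plain X ts (flip d x₀) s∈)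

single-plain : ∀ {k n} (X : List (Fin n)) {ts : Dressing k n} {p q} → parity p ≡ false → Single ts p q → Single (plain X ++ ts) p q
single-plain [] even S = S
single-plain (d ∷ X) even S = add ([] ∷ []) even (single-plain X even S)

-- In the new multigraph each edge of label `φ(e_z)` in direction `z` has two further parallel
-- copies. Walking the three copies forth, back and forth has the net effect of the single old step.
-- Upstairs every block switches both new coordinates, between 00 and 11, so the walk closes because
-- `K` is even.
module AddTwo {n q k : ℕ} (Q : Quotient n q k) {K} (T : Trail (Quotient.φ Q) K) (even : ∀ b → toggle K b ≡ b) where
  open Quotient Q
  open Trail T

  quotient : Quotient (2 + n) q (2 + k)
  quotient = addDependent 0F (addDependent z Q)

  φ' : Vertex (2 + n) → Vertex q
  φ' = Quotient.φ quotient

  z' : Fin (2 + n)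
  z' = 2 ↑ʳ z

  φ'-parity : ∀ (p : Vertex 2) x → φ' (p ++ᵛ x) ≡ φ (flipIf (parity p) z x)
  φ'-parity (false ∷ false ∷ []) x = refl
  φ'-parity (false ∷ true ∷ []) x = refl
  φ'-parity (true ∷ false ∷ []) x = refl
  φ'-parity (true ∷ true ∷ []) x = refl

  enlarge : List (Fin n) → List (Fin (2 + n))
  enlarge X = map (2 ↑ʳ_) X ++ 0F ∷ 1F ∷ []

  dress : List (List (Fin n)) → Dressing 2 n
  dress [] = []
  dress (X ∷ Xs) = plain X ++ (0F ∷ 1F ∷ [] , z) ∷ dress Xs

  expand-dress : ∀ Xs → expand (dress Xs) ≡ joinBlocks z' (map enlarge Xs)
  expand-dress [] = refl
  expand-dress (X ∷ Xs) = trans (expand-plain X _)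
    (trans (cong (λ w → map (2 ↑ʳ_) X ++ 0F ∷ 1F ∷ z' ∷ w) (expand-dress Xs))
           (sym (++-assoc (map (2 ↑ʳ_) X) (0F ∷ 1F ∷ []) _)))

  bare-dress : ∀ Xs → bare (dress Xs) ≡ joinBlocks z Xs
  bare-dress [] = refl
  bare-dress (X ∷ Xs) = trans (bare-plain X) (cong (λ w → X ++ z ∷ w) (bare-dress Xs))
    where
    bare-plain : ∀ X {ts : Dressing 2 n} → bare (plain X ++ ts) ≡ X ++ bare ts
    bare-plain [] = refl
    bare-plain (d ∷ X) = cong (d ∷_) (bare-plain X)

  single-dress : ∀ Xs b → let c = toggle (length Xs) b in Single (dress Xs) (b ∷ b ∷ []) (c ∷ c ∷ [])
  single-dress [] b = []
  single-dress (X ∷ Xs) false = single-plain X refl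
    (add (toWitness {a? = uniqueVertices? (trace (0F ∷ 1F ∷ []) (false ∷ false ∷ []))} _) refl (single-dress Xs true))
  single-dress (X ∷ Xs) true = single-plain X refl
    (add (toWitness {a? = uniqueVertices? (trace (0F ∷ 1F ∷ []) (true ∷ true ∷ []))} _) refl (single-dress Xs false))

  S : Single (dress blocks) (false ∷ false ∷ []) (false ∷ false ∷ [])
  S = subst (λ c → Single (dress blocks) (false ∷ false ∷ []) (c ∷ c ∷ []))
        (trans (cong (λ K → toggle K false) blockCount) (even false)) (single-dress blocks false)

  matched-site : ∀ Xs x₀ {x} → All (All (_≢ z)) Xs → (x , z) ∈ steps (joinBlocks z Xs) x₀ →
    (x , 0F ∷ 1F ∷ []) ∈ sites (dress Xs) x₀
  matched-site (X ∷ Xs) x₀ (a ∷ as) s with ∈-++⁻ (steps X x₀) (subst (_ ∈_) (steps-++ X (z ∷ joinBlocks z Xs) x₀) s)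
  ... | inj₁ s' = contradiction refl (All.lookup a (step-letter X x₀ s'))
  ... | inj₂ (here refl) = sites-plain X _ x₀ (here refl)
  ... | inj₂ (there s') = sites-plain X _ x₀ (there (matched-site Xs _ as s'))

  word' : List (Fin (2 + n))
  word' = joinBlocks z' (map enlarge blocks)

  euler-old : ∀ r d → ∃[ x ] ((x , 2 ↑ʳ d) ∈ steps word' origin × (φ' x ≡ r ⊎ φ' (flip (2 ↑ʳ d) x) ≡ r))
  euler-old r d with euler r d
  ... | x , s , e with single-step S origin (subst (λ w → (x , d) ∈ steps w origin) (sym (bare-dress blocks)) s)
  ...   | p , p-even , s' = p ++ᵛ x , subst (λ w → _ ∈ steps w origin) (expand-dress blocks) s' , found e
    where
    φ'-even : ∀ y → φ' (p ++ᵛ y) ≡ φ y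
    φ'-even y = trans (φ'-parity p y) (cong (λ b → φ (flipIf b z y)) p-even)
    found : φ x ≡ r ⊎ φ (flip d x) ≡ r → _
    found (inj₁ e) = inj₁ (trans (φ'-even x) e)
    found (inj₂ e) = inj₂ (trans (cong φ' (flip-++ʳ d p x)) (trans (φ'-even (flip d x)) e))

  -- Over the start `x` of a `z` step the image is `φ x` or `φ (flip z x)`, according to the parity
  -- of the new coordinates. A new letter exchanges the two, so its step has both images as ends,
  -- and one of them is `r`.
  euler-new : ∀ r e → e ∈ 0F ∷ 1F ∷ [] →
    ∃[ x ] ((x , e ↑ˡ n) ∈ steps word' origin × (φ' x ≡ r ⊎ φ' (flip (e ↑ˡ n) x) ≡ r))
  euler-new r e e∈ with euler r z
  ... | x , s , f with inserted-step (dress blocks) (false ∷ false ∷ []) origin (matched-site blocks origin avoids s) e∈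
  ...   | p , s' = p ++ᵛ x , subst (λ w → _ ∈ steps w origin) (expand-dress blocks) s' , found (parity p) refl f
    where
    found : ∀ b → parity p ≡ b → φ x ≡ r ⊎ φ (flip z x) ≡ r → φ' (p ++ᵛ x) ≡ r ⊎ φ' (flip (e ↑ˡ n) (p ++ᵛ x)) ≡ r
    at-p : ∀ {b} → parity p ≡ b → φ' (p ++ᵛ x) ≡ φ (flipIf b z x)
    at-p eq = trans (φ'-parity p x) (cong (λ b → φ (flipIf b z x)) eq)
    after-e : ∀ {b} → parity p ≡ b → φ' (flip (e ↑ˡ n) (p ++ᵛ x)) ≡ φ (flipIf (not b) z x)
    after-e eq = trans (cong φ' (flip-++ˡ e p x)) (trans (φ'-parity (flip e p) x)
      (cong (λ b → φ (flipIf b z x)) (trans (parity-flip e p) (cong not eq))))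
    found false eq (inj₁ f) = inj₁ (trans (at-p eq) f)
    found false eq (inj₂ f) = inj₂ (trans (after-e eq) f)
    found true eq (inj₁ f) = inj₂ (trans (after-e eq) f)
    found true eq (inj₂ f) = inj₁ (trans (at-p eq) f)

  euler' : ∀ r d → ∃[ x ] ((x , d) ∈ steps word' origin × (φ' x ≡ r ⊎ φ' (flip d x) ≡ r))
  euler' r zero = euler-new r 0F (here refl)
  euler' r (suc zero) = euler-new r 1F (there (here refl))
  euler' r (suc (suc d)) = euler-old r d

  trail : Trail φ' K
  trail = record
    { z = z'
    ; blocks = map enlarge blocks
    ; blockCount = trans (length-map enlarge blocks) blockCount
    ; sizes = Allₚ.map⁺ (All.map (λ {X} → enlarge-size X) sizes)
    ; avoids = Allₚ.map⁺ (All.map (λ {X} → enlarge-avoids X) avoids)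
    ; closed = subst (λ w → run w origin ≡ origin) (expand-dress blocks)
        (trans (single-run S origin) (cong ((false ∷ false ∷ []) ++ᵛ_) (trans (cong (λ w → run w origin) (bare-dress blocks)) closed)))
    ; simple = subst (λ w → Unique (visits w origin)) (expand-dress blocks)
        (single-simple S origin (subst (λ w → Unique (visits w origin)) (sym (bare-dress blocks)) simple))
    ; euler = euler'
    }
    where
    enlarge-size : ∀ X → suc (length X) ≡ n → suc (length (enlarge X)) ≡ 2 + n
    enlarge-size X e = trans (cong suc (trans (length-++ (map (2 ↑ʳ_) X)) (trans (+-comm _ 2) (cong (2 +_) (length-map _ X))))) (cong (2 +_) e)
    enlarge-avoids : ∀ X → All (_≢ z) X → All (_≢ z') (enlarge X)
    enlarge-avoids X a = Allₚ.++⁺ (Allₚ.map⁺ (All.map (λ ne eq → ne (Finₚ.suc-injective (Finₚ.suc-injective eq))) a)) ((λ ()) ∷ (λ ()) ∷ [])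

-- From (m , n) to (m + 1 , n + 4): two passes with four new letters

cons : ∀ {A : Set} → A × List A → List A
cons (a , as) = a ∷ as

-- The first block ends with two letters of equal label.
record Doubled {n q} (φ : Vertex n → Vertex q) (blocks : List (List (Fin n))) : Set where
  field
    l d d' : Fin n
    X : List (Fin n)
    rest : List (Fin n × List (Fin n))
    shape : blocks ≡ (l ∷ X ++ d ∷ d' ∷ []) ∷ map cons rest
    same : ∀ x → φ (flip d' (flip d x)) ≡ φ x

plain₂ : ∀ {k n} → List (Fin n) → Dressing₂ k n
plain₂ = map (([] , []) ,_)

expand-first-plain₂ : ∀ {k n} (X : List (Fin n)) (ts : Dressing₂ k n) →
  expand (first (plain₂ X ++ ts)) ≡ map (k ↑ʳ_) X ++ expand (first ts)
expand-first-plain₂ [] ts = refl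
expand-first-plain₂ {k} (d ∷ X) ts = cong ((k ↑ʳ d) ∷_) (expand-first-plain₂ X ts)

expand-second-plain₂ : ∀ {k n} (X : List (Fin n)) (ts : Dressing₂ k n) →
  expand (second (plain₂ X ++ ts)) ≡ map (k ↑ʳ_) X ++ expand (second ts)
expand-second-plain₂ [] ts = refl
expand-second-plain₂ {k} (d ∷ X) ts = cong ((k ↑ʳ d) ∷_) (expand-second-plain₂ X ts)

bare-plain₂ : ∀ {k n} (X : List (Fin n)) (ts : Dressing₂ k n) → map proj₂ (plain₂ X ++ ts) ≡ X ++ map proj₂ ts
bare-plain₂ [] ts = refl
bare-plain₂ (d ∷ X) ts = cong (d ∷_) (bare-plain₂ X ts)

double-plain₂ : ∀ {k n} (X : List (Fin n)) {ts : Dressing₂ k n} {p p' q q'} → p ≢ p' → parity p ≡ not (parity p') →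
  Double ts p p' q q' → Double (plain₂ X ++ ts) p p' q q'
double-plain₂ [] ne opp D = D
double-plain₂ (d ∷ X) ne opp D = add ((ne ∷ []) ∷ [] ∷ []) opp (double-plain₂ X ne opp D)

add! : ∀ {k n} {i j} {d : Fin n} {ts : Dressing₂ k n} {p p' q q'} {distinct : True (uniqueVertices? (trace i p ++ trace j p'))} →
  parity (run i p) ≡ not (parity (run j p')) → Double ts (run i p) (run j p') q q' → Double (((i , j) , d) ∷ ts) p p' q q'
add! {i = i} {j = j} {p = p} {p' = p'} {distinct = distinct} = add (toWitness {a? = uniqueVertices? (trace i p ++ trace j p')} distinct)

sites₂ : ∀ {k n} → Dressing₂ k n → Vertex n → List (Vertex n × (List (Fin k) × List (Fin k)))
sites₂ [] x = []
sites₂ ((ij , d) ∷ ts) x = (x , ij) ∷ sites₂ ts (flip d x)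

sites₂-plain : ∀ {k n} (X : List (Fin n)) (ts : Dressing₂ k n) x₀ {s} → s ∈ sites₂ ts (run X x₀) → s ∈ sites₂ (plain₂ X ++ ts) x₀
sites₂-plain [] ts x₀ s∈ = s∈
sites₂-plain (d ∷ X) ts x₀ s∈ = there (sites₂-plain X ts (flip d x₀) s∈)

sites-first : ∀ {k n} (ts : Dressing₂ k n) x₀ {x i j} → (x , (i , j)) ∈ sites₂ ts x₀ → (x , i) ∈ sites (first ts) x₀
sites-first (_ ∷ ts) x₀ (here refl) = here refl
sites-first ((_ , d) ∷ ts) x₀ (there s) = there (sites-first ts (flip d x₀) s)

sites-second : ∀ {k n} (ts : Dressing₂ k n) x₀ {x i j} → (x , (i , j)) ∈ sites₂ ts x₀ → (x , j) ∈ sites (second ts) x₀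
sites-second (_ ∷ ts) x₀ (here refl) = here refl
sites-second ((_ , d) ∷ ts) x₀ (there s) = there (sites-second ts (flip d x₀) s)

-- Let l X d d' be the first block and A run over the others, ζ being the old matched letter.  The new word is
--   pass 1:  [y u] l X [u v] d d' [z] ζ,  then  [y u] A [v z] ζ  for each A;
--   pass 2:  l X d d' [y] ζ,  then  [v z] A [u y] ζ  for each A;  finally  [v z],
-- so that z recurs every n + 4 letters.  All four new letters have the new basis vector as label, and at every old
-- letter the two passes are at places of opposite parity, so both lifts of each old edge are traversed.  Each new
-- letter is inserted once over each element of the old quotient: at the ends of the matched edges, except that u and v
-- avoid the end of the first block and use the vertex before d d', which has the same image.
module AddFour {n q k : ℕ} (Q : Quotient n q k) {K} (T : Trail (Quotient.φ Q) K)
  (D : Doubled (Quotient.φ Q) (Trail.blocks T)) (even : ∀ b → toggle K b ≡ b) where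
  open Quotient Q
  open Trail T renaming (z to ζ)
  open Doubled D

  pattern y = 0F
  pattern z = 1F
  pattern u = 2F
  pattern v = 3F

  quotient : Quotient (4 + n) (suc q) (3 + k)
  quotient = addDependent 0F (addDependent 0F (addDependent 0F (addIndependent Q)))

  φ' : Vertex (4 + n) → Vertex (suc q)
  φ' = Quotient.φ quotient

  φ'-parity : ∀ (p : Vertex 4) x → φ' (p ++ᵛ x) ≡ parity p ∷ φ x
  φ'-parity (a ∷ b ∷ c ∷ e ∷ []) x =
    trans (absorb a b (addDependent 0F (addDependent 0F (addIndependent Q))))
    (trans (absorb (a xor b) c (addDependent 0F (addIndependent Q)))
    (trans (absorb ((a xor b) xor c) e (addIndependent Q))
    (cong (_∷ φ x) (trans (xor-assoc (a xor b) c e) (trans (xor-assoc a b (c xor e))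
      (cong (λ e → a xor (b xor (c xor e))) (sym (xor-identityʳ e))))))))
    where
    absorb : ∀ {n q k} a b (Q : Quotient (suc n) q k) {x} →
      Quotient.φ (addDependent 0F Q) (a ∷ b ∷ x) ≡ Quotient.φ Q ((a xor b) ∷ x)
    absorb false b Q = refl
    absorb true b Q = refl

  old : Fin n → Fin (4 + n)
  old = 4 ↑ʳ_

  headBlock turnTail : List (Fin (4 + n))
  headBlock = y ∷ (u ∷ old l ∷ map old X ++ u ∷ v ∷ []) ++ old d ∷ old d' ∷ []
  turnTail = old l ∷ map old X ++ old d ∷ old d' ∷ y ∷ old ζ ∷ v ∷ []

  -- In pass 1 each `z` stands right before ζ, so ζ opens the next new block; in pass 2 it stands
  -- right before the first letter of an old block, so ζ falls inside. The block formed by `old ζ`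
  -- and `turnTail` runs across the change of pass.
  block₁ block₂ : Fin n × List (Fin n) → Fin (4 + n) × List (Fin (4 + n))
  block₁ (a , A) = old ζ , y ∷ u ∷ old a ∷ map old A ++ v ∷ []
  block₂ (a , A) = old a , map old A ++ u ∷ y ∷ old ζ ∷ v ∷ []

  rest' : List (Fin (4 + n) × List (Fin (4 + n)))
  rest' = map block₁ rest ++ (old ζ , turnTail) ∷ map block₂ rest

  blocks' : List (List (Fin (4 + n)))
  blocks' = headBlock ∷ map cons rest'

  word' : List (Fin (4 + n))
  word' = joinBlocks z blocks'

  dressRest : List (Fin n × List (Fin n)) → Dressing₂ 4 n
  dressRest [] = []
  dressRest ((a , A) ∷ t) = ((y ∷ u ∷ [] , v ∷ z ∷ []) , a) ∷ plain₂ A ++ ((v ∷ z ∷ [] , u ∷ y ∷ []) , ζ) ∷ dressRest t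

  -- With u v z all inserted before the first ζ, pass 1 would reach the end of the first block with
  -- new coordinates `pyu`, the very point to which y takes pass 2 there. Moving u v in front of `d`
  -- lets pass 1 arrive with y and v set, and the traces become disjoint.
  dressTail dressed : Dressing₂ 4 n
  dressTail = plain₂ X ++ ((u ∷ v ∷ [] , []) , d) ∷ (([] , []) , d') ∷ ((z ∷ [] , y ∷ []) , ζ) ∷ dressRest rest
  dressed = ((v ∷ z ∷ y ∷ u ∷ [] , []) , l) ∷ dressTail

  -- The insertion in front of the first letter straddles the start of the word: v z belongs to its end.
  pass₁ pass₂ : List (Fin (4 + n))
  pass₁ = y ∷ u ∷ old l ∷ expand (first dressTail)
  pass₂ = expand (second dressed)

  bare-dressRest : ∀ t → map proj₂ (dressRest t) ≡ joinBlocks ζ (map cons t)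
  bare-dressRest [] = refl
  bare-dressRest ((a , A) ∷ t) = cong (a ∷_) (trans (bare-plain₂ A _) (cong (λ w → A ++ ζ ∷ w) (bare-dressRest t)))

  bare-dressed : map proj₂ dressed ≡ word
  bare-dressed = trans (cong (l ∷_) (trans (bare-plain₂ X _)
    (trans (cong (λ w → X ++ d ∷ d' ∷ ζ ∷ w) (bare-dressRest rest)) (sym (++-assoc X (d ∷ d' ∷ []) _)))))
    (cong (joinBlocks ζ) (sym shape))

  join-block₁ : ∀ t w ws → joinBlocks z (map cons (map block₁ t ++ (old ζ , w) ∷ ws)) ≡
    old ζ ∷ expand (first (dressRest t)) ++ w ++ z ∷ joinBlocks z (map cons ws)
  join-block₁ [] w ws = refl
  join-block₁ ((a , A) ∷ t) w ws = cong (λ w → old ζ ∷ y ∷ u ∷ old a ∷ w)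
    (trans (++-assoc (map old A) _ _)
    (trans (cong (λ w → map old A ++ v ∷ z ∷ w) (join-block₁ t w ws))
    (trans (sym (++-assoc (map old A) _ _)) (cong (_++ _) (sym (expand-first-plain₂ A _))))))

  join-block₂ : ∀ t → v ∷ z ∷ joinBlocks z (map cons (map block₂ t)) ≡ expand (second (dressRest t)) ++ v ∷ z ∷ []
  join-block₂ [] = refl
  join-block₂ ((a , A) ∷ t) = cong (λ w → v ∷ z ∷ old a ∷ w)
    (trans (++-assoc (map old A) _ _)
    (trans (cong (λ w → map old A ++ u ∷ y ∷ old ζ ∷ w) (join-block₂ t))
    (trans (sym (++-assoc (map old A) _ _)) (cong (_++ _) (sym (expand-second-plain₂ A _))))))

  word'-passes : word' ≡ pass₁ ++ pass₂ ++ v ∷ z ∷ []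
  word'-passes = cong (λ w → y ∷ u ∷ old l ∷ w)
    (trans (cong (_++ z ∷ joinBlocks z (map cons rest')) (++-assoc (map old X) (u ∷ v ∷ []) (old d ∷ old d' ∷ [])))
    (trans (++-assoc (map old X) _ _)
    (trans (cong (λ w → map old X ++ u ∷ v ∷ old d ∷ old d' ∷ z ∷ w)
      (trans (join-block₁ rest turnTail (map block₂ rest))
             (cong (λ w → old ζ ∷ expand (first (dressRest rest)) ++ old l ∷ w) turn)))
    (trans (sym (++-assoc (map old X) _ (pass₂ ++ v ∷ z ∷ [])))
           (cong (_++ pass₂ ++ v ∷ z ∷ []) (sym (expand-first-plain₂ X _)))))))
    where
    turn : (map old X ++ old d ∷ old d' ∷ y ∷ old ζ ∷ v ∷ []) ++ z ∷ joinBlocks z (map cons (map block₂ rest)) ≡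
      expand (second dressTail) ++ v ∷ z ∷ []
    turn = trans (++-assoc (map old X) _ _)
      (trans (cong (λ w → map old X ++ old d ∷ old d' ∷ y ∷ old ζ ∷ w) (join-block₂ rest))
      (trans (sym (++-assoc (map old X) _ _)) (cong (_++ _) (sym (expand-second-plain₂ X _)))))

  -- Each name lists the coordinates that are set, in the order y, z, u, v of the vector. Between
  -- blocks the two passes are at `pyzv` and `pyu`, or at `pu` and `pvz`; every block of `rest`
  -- exchanges these two situations.
  pu pvz pyu pyzv : Vertex 4
  pu = false ∷ false ∷ true ∷ false ∷ []
  pvz = false ∷ true ∷ false ∷ true ∷ []
  pyu = true ∷ false ∷ true ∷ false ∷ []
  pyzv = true ∷ true ∷ false ∷ true ∷ []

  state₁ state₂ : Bool → Vertex 4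
  state₁ b = if b then pu else pyzv
  state₂ b = if b then pvz else pyu

  double-rest : ∀ t b → let c = toggle (length t) b in Double (dressRest t) (state₁ b) (state₂ b) (state₁ c) (state₂ c)
  double-rest [] b = []
  double-rest ((a , A) ∷ t) false = add! refl (double-plain₂ A (λ ()) refl (add! refl (double-rest t true)))
  double-rest ((a , A) ∷ t) true = add! refl (double-plain₂ A (λ ()) refl (add! refl (double-rest t false)))

  -- Each pass ends where the other one starts, so together they close up. This uses that `rest` has
  -- `K - 1` blocks, an odd number: the situation behind the first block is switched an odd number
  -- of times.
  double : Double dressed pvz pu pu pvz
  double = add! refl (double-plain₂ X (λ ()) refl (add! refl (add! refl (add! refl
    (subst (λ c → Double (dressRest rest) pyzv pyu (state₁ c) (state₂ c)) rest-odd (double-rest rest false))))))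
    where
    rest-odd : toggle (length rest) false ≡ true
    rest-odd = trans (cong (λ K → toggle K true) (trans (cong suc (sym (length-map cons rest)))
      (trans (cong length (sym shape)) blockCount))) (even true)

  dressed-closed : run (map proj₂ dressed) origin ≡ origin
  dressed-closed = trans (cong (λ w → run w origin) bare-dressed) closed

  run-pass₁ : run pass₁ origin ≡ pu ++ᵛ origin
  -- The letters v z lead from `pvz` to zero, so the dressed word started at `pvz` reduces to
  -- `pass₁` started at the origin.
  run-pass₁ = trans (double-run₁ {p = pvz} double origin) (cong (pu ++ᵛ_) dressed-closed)

  run-pass₂ : run pass₂ (pu ++ᵛ origin) ≡ pvz ++ᵛ origin
  run-pass₂ = trans (double-run₂ double origin) (cong (pvz ++ᵛ_) dressed-closed)

  closed' : run word' origin ≡ origin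
  closed' = trans (cong (λ w → run w origin) word'-passes)
    (trans (run-++ pass₁ _ origin) (trans (cong (run (pass₂ ++ v ∷ z ∷ [])) run-pass₁)
    (trans (run-++ pass₂ _ (pu ++ᵛ origin)) (cong (run (v ∷ z ∷ [])) run-pass₂))))

  visits-word' : visits word' origin ≡
    visits pass₁ origin ++ visits pass₂ (pu ++ᵛ origin) ++ visits (v ∷ z ∷ []) (pvz ++ᵛ origin)
  visits-word' = trans (cong (λ w → visits w origin) word'-passes)
    (trans (visits-++ pass₁ _ origin) (cong (visits pass₁ origin ++_)
    (trans (cong (visits (pass₂ ++ v ∷ z ∷ [])) run-pass₁)
    (trans (visits-++ pass₂ _ (pu ++ᵛ origin)) (cong (λ x → visits pass₂ (pu ++ᵛ origin) ++ visits (v ∷ z ∷ []) x) run-pass₂)))))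

  steps-word' : steps word' origin ≡
    steps pass₁ origin ++ steps pass₂ (pu ++ᵛ origin) ++ steps (v ∷ z ∷ []) (pvz ++ᵛ origin)
  steps-word' = trans (cong (λ w → steps w origin) word'-passes)
    (trans (steps-++ pass₁ _ origin) (cong (steps pass₁ origin ++_)
    (trans (cong (steps (pass₂ ++ v ∷ z ∷ [])) run-pass₁)
    (trans (steps-++ pass₂ _ (pu ++ᵛ origin)) (cong (λ x → steps pass₂ (pu ++ᵛ origin) ++ steps (v ∷ z ∷ []) x) run-pass₂)))))

  simple' : Unique (visits word' origin)
  simple' = subst Unique (sym visits-word') (unique-resp-↭ rotate
    (double-simple double origin (subst (λ w → Unique (visits w origin)) (sym bare-dressed) simple)))
    where
    V = visits pass₁ origin
    W = visits pass₂ (pu ++ᵛ origin)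
    U = visits (v ∷ z ∷ []) (pvz ++ᵛ origin)
    -- The letters v z open the dressed first pass but close the new word; the cycle is only read
    -- from another starting point.
    rotate : U ++ V ++ W ↭ V ++ W ++ U
    rotate = ↭-trans (++-comm U (V ++ W)) (↭-reflexive (++-assoc V W U))

  in-pass₁ : ∀ {s} → s ∈ steps (expand (first dressed)) (pvz ++ᵛ origin) → s ∈ steps word' origin
  in-pass₁ {s} m = subst (s ∈_) (sym steps-word') (moved m)
    where
    moved : s ∈ steps (expand (first dressed)) (pvz ++ᵛ origin) → _
    moved (here e) = ∈-++⁺ʳ (steps pass₁ origin) (∈-++⁺ʳ (steps pass₂ _) (here e))
    moved (there (here e)) = ∈-++⁺ʳ (steps pass₁ origin) (∈-++⁺ʳ (steps pass₂ _) (there (here e)))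
    moved (there (there m)) = ∈-++⁺ˡ m

  in-pass₂ : ∀ {s} → s ∈ steps pass₂ (pu ++ᵛ origin) → s ∈ steps word' origin
  in-pass₂ {s} m = subst (s ∈_) (sym steps-word') (∈-++⁺ʳ (steps pass₁ origin) (∈-++⁺ˡ m))

  Covered : Vertex (suc q) → Fin (4 + n) → Set
  Covered r e = ∃[ x ] ((x , e) ∈ steps word' origin × (φ' x ≡ r ⊎ φ' (flip e x) ≡ r))

  euler-old : ∀ b r d → Covered (b ∷ r) (old d)
  euler-old b r e with euler r e
  ... | x , s , f with double-step double origin (subst (λ w → (x , e) ∈ steps w origin) (sym bare-dressed) s)
  ...   | p , p' , opp , m , m' = choose b (parity p') refl
    where
    at : ∀ s {c} → parity s ≡ c → (s ++ᵛ x , old e) ∈ steps word' origin → Covered (c ∷ r) (old e)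
    at s refl m = s ++ᵛ x , m , found f
      where
      found : φ x ≡ r ⊎ φ (flip e x) ≡ r → _
      found (inj₁ f) = inj₁ (trans (φ'-parity s x) (cong (parity s ∷_) f))
      found (inj₂ f) = inj₂ (trans (cong φ' (flip-++ʳ e s x)) (trans (φ'-parity s (flip e x)) (cong (parity s ∷_) f)))
    choose : ∀ b c → parity p' ≡ c → Covered (b ∷ r) (old e)
    choose false false eq = at p' eq (in-pass₂ m')
    choose true false eq = at p (trans opp (cong not eq)) (in-pass₁ m)
    choose false true eq = at p (trans opp (cong not eq)) (in-pass₁ m)
    choose true true eq = at p' eq (in-pass₂ m')

  InsertedOver : Vertex q → Fin 4 → Set
  InsertedOver r e = ∃[ x ] ∃[ i ] ∃[ j ] ((x , (i , j)) ∈ sites₂ dressed origin × φ x ≡ r × (e ∈ i ⊎ e ∈ j))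

  -- A new letter changes the parity and leaves `x` alone, so its step joins the two elements over
  -- `r`: one insertion serves both values of `b`.
  inserted⇒covered : ∀ b r e → InsertedOver r e → Covered (b ∷ r) (e ↑ˡ n)
  inserted⇒covered b r e (x , i , j , s , f , e∈) = either e∈
    where
    at : ∀ p → (p ++ᵛ x , e ↑ˡ n) ∈ steps word' origin → Covered (b ∷ r) (e ↑ˡ n)
    at p m = p ++ᵛ x , m , choose b (parity p) refl
      where
      before : φ' (p ++ᵛ x) ≡ parity p ∷ r
      before = trans (φ'-parity p x) (cong (parity p ∷_) f)
      after : φ' (flip (e ↑ˡ n) (p ++ᵛ x)) ≡ not (parity p) ∷ r
      after = trans (cong φ' (flip-++ˡ e p x)) (trans (φ'-parity (flip e p) x) (cong₂ _∷_ (parity-flip e p) f))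
      choose : ∀ b c → parity p ≡ c → φ' (p ++ᵛ x) ≡ b ∷ r ⊎ φ' (flip (e ↑ˡ n) (p ++ᵛ x)) ≡ b ∷ r
      choose false false eq = inj₁ (trans before (cong (_∷ r) eq))
      choose false true eq = inj₂ (trans after (cong (λ c → not c ∷ r) eq))
      choose true false eq = inj₂ (trans after (cong (λ c → not c ∷ r) eq))
      choose true true eq = inj₁ (trans before (cong (_∷ r) eq))
    either : e ∈ i ⊎ e ∈ j → Covered (b ∷ r) (e ↑ˡ n)
    either (inj₁ e∈i) with inserted-step (first dressed) pvz origin (sites-first dressed origin s) e∈i
    ... | p , m = at p (in-pass₁ m)
    either (inj₂ e∈j) with inserted-step (second dressed) pu origin (sites-second dressed origin s) e∈j
    ... | p , m = at p (in-pass₂ m)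

  -- At the start and at the end of a block of `rest` the two passes share the four letters between
  -- them; at the origin pass 1 inserts all four.
  atStart : ∀ (e : Fin 4) → e ∈ y ∷ u ∷ [] ⊎ e ∈ v ∷ z ∷ []
  atStart y = inj₁ (here refl)
  atStart z = inj₂ (there (here refl))
  atStart u = inj₁ (there (here refl))
  atStart v = inj₂ (here refl)

  atEnd : ∀ (e : Fin 4) → e ∈ v ∷ z ∷ [] ⊎ e ∈ u ∷ y ∷ []
  atEnd y = inj₂ (there (here refl))
  atEnd z = inj₁ (there (here refl))
  atEnd u = inj₂ (here refl)
  atEnd v = inj₁ (here refl)

  atOrigin : ∀ (e : Fin 4) → e ∈ v ∷ z ∷ y ∷ u ∷ []
  atOrigin y = there (there (here refl))
  atOrigin z = there (here refl)
  atOrigin u = there (there (there (here refl)))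
  atOrigin v = here refl

  Start End : Vertex n → Vertex n × (List (Fin 4) × List (Fin 4))
  Start x = x , (y ∷ u ∷ [] , v ∷ z ∷ [])
  End x = x , (v ∷ z ∷ [] , u ∷ y ∷ [])

  -- A ζ step departs from the end of a block. It arrives at the start of the next block or, behind
  -- the last block, at the end of the whole word, which is the origin again.
  matched-site : ∀ t x₀ {x} → All (All (_≢ ζ)) (map cons t) → (x , ζ) ∈ steps (joinBlocks ζ (map cons t)) x₀ →
    End x ∈ sites₂ (dressRest t) x₀ ×
    (Start (flip ζ x) ∈ sites₂ (dressRest t) x₀ ⊎ flip ζ x ≡ run (joinBlocks ζ (map cons t)) x₀)
  matched-site ((a , A) ∷ t) x₀ {x} (av ∷ avs) s
    with ∈-++⁻ (steps (a ∷ A) x₀) (subst ((x , ζ) ∈_) (steps-++ (a ∷ A) (ζ ∷ joinBlocks ζ (map cons t)) x₀) s)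
  ... | inj₁ s' = contradiction refl (All.lookup av (step-letter (a ∷ A) x₀ s'))
  ... | inj₂ (here refl) = there (sites₂-plain A _ _ (here refl)) , following t refl
    where
    following : ∀ t' → t ≡ t' → Start (flip ζ x) ∈ sites₂ (dressRest ((a , A) ∷ t)) x₀ ⊎
                flip ζ x ≡ run (joinBlocks ζ (map cons ((a , A) ∷ t))) x₀
    following [] refl = inj₂ (sym (run-++ (a ∷ A) (ζ ∷ []) x₀))
    following (_ ∷ _) refl = inj₁ (there (sites₂-plain A _ _ (there (here refl))))
  ... | inj₂ (there s') with matched-site t _ avs s'
  ...   | end , start = there (sites₂-plain A _ _ (there end)) , shift start
    where
    shift : Start (flip ζ x) ∈ sites₂ (dressRest t) _ ⊎ flip ζ x ≡ run (joinBlocks ζ (map cons t)) _ → _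
    shift (inj₁ m) = inj₁ (there (sites₂-plain A _ _ (there m)))
    shift (inj₂ eq) = inj₂ (trans eq (sym (run-++ (a ∷ A) _ x₀)))

  -- Every `r` is the image of an end of some ζ step, because the old trail covers direction ζ at
  -- `r`. All four letters are inserted at such an end, except at the end of the first block; there
  -- u and v are found at `o₁`, which `same` shows to have the same image.
  inserted-over : ∀ r e → InsertedOver r e
  inserted-over r e with euler r ζ
  ... | x , s , f = locate (∈-++⁻ (steps X₀ origin) (subst ((x , ζ) ∈_) (steps-++ X₀ _ origin) s₀)) f
    where
    X₀ = l ∷ X ++ d ∷ d' ∷ []
    word₀ = joinBlocks ζ (map cons rest)
    s₀ : (x , ζ) ∈ steps (X₀ ++ ζ ∷ word₀) origin
    s₀ = subst (λ Xs → (x , ζ) ∈ steps (joinBlocks ζ Xs) origin) shape s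
    closed₀ : run word₀ (flip ζ (run X₀ origin)) ≡ origin
    closed₀ = trans (sym (run-++ X₀ _ origin)) (trans (cong (λ Xs → run (joinBlocks ζ Xs) origin) (sym shape)) closed)
    avoids₀ : All (All (_≢ ζ)) (X₀ ∷ map cons rest)
    avoids₀ = subst (All (All (_≢ ζ))) shape avoids
    o₁ = run (l ∷ X) origin
    o₂ : flip d' (flip d o₁) ≡ run X₀ origin
    o₂ = sym (run-++ (l ∷ X) (d ∷ d' ∷ []) origin)
    in-head : ∀ {s} → s ∈ sites₂ (((u ∷ v ∷ [] , []) , d) ∷ (([] , []) , d') ∷ ((z ∷ [] , y ∷ []) , ζ) ∷ dressRest rest) o₁ →
      s ∈ sites₂ dressed origin
    in-head m = there (sites₂-plain X _ _ m)
    in-rest : ∀ {s} → s ∈ sites₂ (dressRest rest) (flip ζ (run X₀ origin)) → s ∈ sites₂ dressed origin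
    in-rest m = in-head (there (there (there (subst (λ x → _ ∈ sites₂ (dressRest rest) (flip ζ x)) (sym o₂) m))))
    origin-over : ∀ {x'} → φ x' ≡ r → x' ≡ origin → InsertedOver r e
    origin-over f refl = origin , _ , _ , here refl , f , inj₁ (atOrigin e)
    start-over : φ (flip ζ x) ≡ r →
      Start (flip ζ x) ∈ sites₂ (dressRest rest) (flip ζ (run X₀ origin)) ⊎ flip ζ x ≡ run word₀ (flip ζ (run X₀ origin)) → InsertedOver r e
    start-over f (inj₁ m) = _ , _ , _ , in-rest m , f , atStart e
    start-over f (inj₂ eq) = origin-over f (trans eq closed₀)
    head-end : ∀ e → φ (run X₀ origin) ≡ r → InsertedOver r e
    head-end y f = _ , _ , _ , in-head (there (there (here refl))) , trans (cong φ o₂) f , inj₂ (here refl)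
    head-end z f = _ , _ , _ , in-head (there (there (here refl))) , trans (cong φ o₂) f , inj₁ (here refl)
    head-end u f = _ , _ , _ , in-head (here refl) , trans (sym (same o₁)) (trans (cong φ o₂) f) , inj₁ (here refl)
    head-end v f = _ , _ , _ , in-head (here refl) , trans (sym (same o₁)) (trans (cong φ o₂) f) , inj₁ (there (here refl))
    head-start : ∀ t → rest ≡ t → Start (flip ζ (run X₀ origin)) ∈ sites₂ (dressRest rest) (flip ζ (run X₀ origin)) ⊎
      flip ζ (run X₀ origin) ≡ run word₀ (flip ζ (run X₀ origin))
    head-start [] eq rewrite eq = inj₂ refl
    head-start (_ ∷ _) eq rewrite eq = inj₁ (here refl)
    locate : (x , ζ) ∈ steps X₀ origin ⊎ (x , ζ) ∈ steps (ζ ∷ word₀) (run X₀ origin) → φ x ≡ r ⊎ φ (flip ζ x) ≡ r → InsertedOver r e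
    locate (inj₁ s) f = contradiction refl (All.lookup (All.head avoids₀) (step-letter X₀ origin s))
    locate (inj₂ (here refl)) (inj₁ f) = head-end e f
    locate (inj₂ (here refl)) (inj₂ f) = start-over f (head-start rest refl)
    locate (inj₂ (there s)) f with matched-site rest _ (All.tail avoids₀) s | f
    ... | end , start | inj₁ f = _ , _ , _ , in-rest end , f , atEnd e
    ... | end , start | inj₂ f = start-over f start

  euler' : ∀ r e → Covered r e
  euler' (b ∷ r) (suc (suc (suc (suc d)))) = euler-old b r d
  euler' (b ∷ r) y = inserted⇒covered b r y (inserted-over r y)
  euler' (b ∷ r) z = inserted⇒covered b r z (inserted-over r z)
  euler' (b ∷ r) u = inserted⇒covered b r u (inserted-over r u)
  euler' (b ∷ r) v = inserted⇒covered b r v (inserted-over r v)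

  length-map-++ : ∀ A B → length (map old A ++ B) ≡ length B + length A
  length-map-++ A B = trans (length-++ (map old A)) (trans (+-comm _ (length B)) (cong (length B +_) (length-map old A)))

  sizes' : All (λ A → suc (length A) ≡ 4 + n) blocks'
  sizes' with subst (All (λ A → suc (length A) ≡ n)) shape sizes
  ... | size ∷ sizes₀ = head-size ∷ Allₚ.map⁺ (Allₚ.++⁺ (Allₚ.map⁺ (All.map (λ {a} → size₁ a) (Allₚ.map⁻ sizes₀)))
          (turn-size ∷ Allₚ.map⁺ (All.map (λ {a} → size₂ a) (Allₚ.map⁻ sizes₀))))
    where
    a = length X
    n-size : 4 + a ≡ n
    n-size = trans (cong (2 +_) (sym (trans (length-++ X) (+-comm a 2)))) size
    head-size : suc (length headBlock) ≡ 4 + n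
    head-size = trans (cong (3 +_) (trans (length-++ (old l ∷ map old X ++ u ∷ v ∷ [])) (trans (+-comm _ 2) (cong (3 +_) (length-map-++ X _)))))
      (cong (4 +_) n-size)
    turn-size : suc (suc (length turnTail)) ≡ 4 + n
    turn-size = trans (cong (3 +_) (length-map-++ X _)) (cong (4 +_) n-size)
    size₁ : ∀ a → suc (length (cons a)) ≡ n → suc (length (cons (block₁ a))) ≡ 4 + n
    size₁ (a , A) e = trans (cong (5 +_) (length-map-++ A _)) (cong (4 +_) e)
    size₂ : ∀ a → suc (length (cons a)) ≡ n → suc (length (cons (block₂ a))) ≡ 4 + n
    size₂ (a , A) e = trans (cong (2 +_) (length-map-++ A _)) (cong (4 +_) e)

  avoids' : All (All (_≢ z)) blocks'
  avoids' = ((λ ()) ∷ Allₚ.++⁺ ((λ ()) ∷ (λ ()) ∷ old-avoids X ((λ ()) ∷ (λ ()) ∷ [])) ((λ ()) ∷ (λ ()) ∷ []))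
    ∷ Allₚ.map⁺ (Allₚ.++⁺ (Allₚ.map⁺ (All.universal avoid₁ rest)) (((λ ()) ∷ (λ ()) ∷ old-avoids X ((λ ()) ∷ (λ ()) ∷ (λ ()) ∷ (λ ()) ∷ (λ ()) ∷ []))
        ∷ Allₚ.map⁺ (All.universal avoid₂ rest)))
    where
    old-avoids : ∀ A {B} → All (_≢ z) B → All (_≢ z) (map old A ++ B)
    old-avoids A b = Allₚ.++⁺ (Allₚ.map⁺ (All.universal (λ _ ()) A)) b
    avoid₁ : ∀ a → All (_≢ z) (cons (block₁ a))
    avoid₁ (a , A) = (λ ()) ∷ (λ ()) ∷ (λ ()) ∷ (λ ()) ∷ old-avoids A ((λ ()) ∷ [])
    avoid₂ : ∀ a → All (_≢ z) (cons (block₂ a))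
    avoid₂ (a , A) = (λ ()) ∷ old-avoids A ((λ ()) ∷ (λ ()) ∷ (λ ()) ∷ (λ ()) ∷ [])

  blockCount' : length blocks' ≡ K + K
  blockCount' = trans (cong suc (trans (length-map cons rest') (trans (length-++ (map block₁ rest))
    (cong₂ (λ a b → a + suc b) (length-map block₁ rest) (length-map block₂ rest))))) (cong₂ _+_ count count)
    where
    count : suc (length rest) ≡ K
    count = trans (cong suc (sym (length-map cons rest))) (trans (cong length (sym shape)) blockCount)

  trail : Trail φ' (K + K)
  trail = record
    { z = z ; blocks = blocks' ; blockCount = blockCount' ; sizes = sizes' ; avoids = avoids'
    ; closed = closed' ; simple = simple' ; euler = euler' }

  -- Nothing is inserted between or behind `d` and `d'` in pass 1, so the new first block ends with
  -- the same pair and the construction can be repeated.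
  doubled : Doubled φ' blocks'
  doubled = record
    { l = y ; d = old d ; d' = old d' ; X = u ∷ old l ∷ map old X ++ u ∷ v ∷ [] ; rest = rest' ; shape = refl
    ; same = λ { (a ∷ b ∷ c ∷ e ∷ x) → let p = a ∷ b ∷ c ∷ e ∷ [] in
        trans (φ'-parity p _) (trans (cong (parity p ∷_) (same x)) (sym (φ'-parity p x))) } }

-- Explicit starting words, checked by evaluation

_≟ᵛ_ : ∀ {n} (x x' : Vertex n) → Dec (x ≡ x')
_≟ᵛ_ = ≡-dec Bool._≟_

allVertices? : ∀ {n} {P : Vertex n → Set} → (∀ x → Dec (P x)) → Dec (∀ x → P x)
allVertices? {zero} P? = map′ (λ { p [] → p }) (λ f → f []) (P? [])
allVertices? {suc n} P? = map′
  (λ { (p , q) (false ∷ x) → p x ; (p , q) (true ∷ x) → q x })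
  (λ f → (λ x → f (false ∷ x)) , (λ x → f (true ∷ x)))
  (allVertices? (λ x → P? (false ∷ x)) ×-dec allVertices? (λ x → P? (true ∷ x)))

module _ {n q k} (Q : Quotient n q k) (z : Fin n) (blocks : List (List (Fin n))) where
  open Quotient Q

  euler? : Dec (∀ r d → Any (λ (x , d') → d' ≡ d × (φ x ≡ r ⊎ φ (flip d x) ≡ r)) (steps (joinBlocks z blocks) origin))
  euler? = allVertices? λ r → Finₚ.all? λ d → any? (λ (x , d') → (d' Fin.≟ d) ×-dec ((φ x ≟ᵛ r) ⊎-dec (φ (flip d x) ≟ᵛ r))) _

  checkedTrail :
    {True (All.all? (λ X → suc (length X) ℕ.≟ n) blocks)} →
    {True (All.all? (All.all? (λ d → ¬? (d Fin.≟ z))) blocks)} →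
    {True (run (joinBlocks z blocks) origin ≟ᵛ origin)} →
    {True (uniqueVertices? (visits (joinBlocks z blocks) origin))} →
    {True euler?} →
    Trail φ (length blocks)
  checkedTrail {size} {avoid} {close} {distinct} {cover} = record
    { z = z
    ; blocks = blocks
    ; blockCount = refl
    ; sizes = toWitness size
    ; avoids = toWitness avoid
    ; closed = toWitness close
    ; simple = toWitness distinct
    ; euler = λ r d → witness (find (toWitness cover r d))
    }
    where
    witness : ∀ {r d} → (∃[ s ] (s ∈ steps (joinBlocks z blocks) origin × (proj₂ s ≡ d × (φ (proj₁ s) ≡ r ⊎ φ (flip d (proj₁ s)) ≡ r)))) →
      ∃[ x ] ((x , d) ∈ steps (joinBlocks z blocks) origin × (φ x ≡ r ⊎ φ (flip d x) ≡ r))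
    witness ((x , d) , s , refl , f) = x , s , f

quotient₂ : Quotient 2 2 0
quotient₂ = addIndependent (addIndependent trivialQuotient)

trail₂ : Trail (Quotient.φ quotient₂) 2
trail₂ = checkedTrail quotient₂ 1F ((0F ∷ []) ∷ (0F ∷ []) ∷ [])

-- Directions `0F` to `3F` share one label: the multigraph is the 3-cube with the edges of one
-- direction taken four times, the matched letter `2F` being one of the four.
quotient₆ : Quotient 6 3 3
quotient₆ = addDependent 0F (addDependent 0F (addDependent 0F (addIndependent quotient₂)))

trail₆ : Trail (Quotient.φ quotient₆) 4
trail₆ = checkedTrail quotient₆ 2F
  ((3F ∷ 0F ∷ 1F ∷ 5F ∷ 1F ∷ [])
  ∷ (0F ∷ 5F ∷ 4F ∷ 1F ∷ 3F ∷ [])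
  ∷ (5F ∷ 4F ∷ 3F ∷ 4F ∷ 1F ∷ [])
  ∷ (3F ∷ 0F ∷ 5F ∷ 0F ∷ 4F ∷ [])
  ∷ [])

-- Directions `0F` to `4F` share one label: the multigraph is the 4-cube with one direction taken
-- five times. This makes the pair `0F`, `2F` at the end of the first block available for `Doubled`.
quotient₈ : Quotient 8 4 4
quotient₈ = addDependent 0F (addDependent 0F (addDependent 0F (addDependent 0F (addIndependent (addIndependent quotient₂)))))

rest₈ : List (Fin 8 × List (Fin 8))
rest₈ = (5F , 4F ∷ 2F ∷ 0F ∷ 6F ∷ 5F ∷ 0F ∷ [])
    ∷ (2F , 5F ∷ 6F ∷ 1F ∷ 7F ∷ 5F ∷ 2F ∷ [])
    ∷ (7F , 6F ∷ 4F ∷ 7F ∷ 2F ∷ 5F ∷ 1F ∷ [])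
    ∷ (4F , 5F ∷ 0F ∷ 4F ∷ 6F ∷ 5F ∷ 2F ∷ [])
    ∷ (1F , 0F ∷ 4F ∷ 6F ∷ 2F ∷ 7F ∷ 0F ∷ [])
    ∷ (4F , 1F ∷ 2F ∷ 7F ∷ 0F ∷ 6F ∷ 7F ∷ [])
    ∷ (5F , 1F ∷ 7F ∷ 0F ∷ 1F ∷ 4F ∷ 6F ∷ [])
    ∷ []

blocks₈ : List (List (Fin 8))
blocks₈ = (1F ∷ 7F ∷ 1F ∷ 6F ∷ 4F ∷ 0F ∷ 2F ∷ []) ∷ map cons rest₈

trail₈ : Trail (Quotient.φ quotient₈) 8
trail₈ = checkedTrail quotient₈ 3F blocks₈

doubled₈ : Doubled (Quotient.φ quotient₈) blocks₈
doubled₈ = record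
  { l = 1F ; d = 0F ; d' = 2F ; X = 7F ∷ 1F ∷ 6F ∷ 4F ∷ [] ; rest = rest₈ ; shape = refl
  ; same = toWitness {a? = allVertices? λ x → Quotient.φ quotient₈ (flip 2F (flip 0F x)) ≟ᵛ Quotient.φ quotient₈ x} _ }

-- For m = 2 and n = 4 no solution consists of translates of one cycle, as an exhaustive search shows.
decomposes₂₄ : Decomposes 2 4 1
decomposes₂₄ = Assembly.decomposes 2 3 1 (s≤s z≤n) (s≤s z≤n) refl C ℓ
  (toWitness {a? = Finₚ.all? λ i → Finₚ.all? λ t → C i (next t) ≟ᵛ flip (ℓ i t) (C i t)} _)
  (λ i {s} {t} → toWitness {a? = Finₚ.all? λ i → Finₚ.all? λ s → Finₚ.all? λ t → (C i s ≟ᵛ C i t) →-dec (s Fin.≟ t)} _ i s t)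
  (toWitness {a? = allVertices? λ x → Finₚ.all? λ d → Finₚ.any? λ i → Finₚ.any? λ t →
    (ℓ i t Fin.≟ d) ×-dec ((C i t ≟ᵛ x) ⊎-dec (flip d (C i t) ≟ᵛ x))} _)
  (toWitness {a? = allVertices? λ x → Finₚ.any? λ i → Finₚ.any? λ (j : Fin 4) →
    (C i (combine j (fromℕ 3)) ≟ᵛ x) ⊎-dec (C i (next (combine j (fromℕ 3))) ≟ᵛ x)} _)
  where
  start : Fin 2 → Vertex 4
  start 0F = true ∷ false ∷ false ∷ false ∷ []
  start 1F = false ∷ true ∷ false ∷ true ∷ []
  -- Either half changes exactly coordinates 0 and 3, so going through it twice closes the cycle.
  -- The matched letters, at every fourth place, are all `0F` in the first cycle and alternate
  -- between `0F` and `3F` in the second.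
  half : Fin 2 → List (Fin 4)
  half 0F = 1F ∷ 0F ∷ 2F ∷ 0F ∷ 1F ∷ 3F ∷ 2F ∷ 0F ∷ []
  half 1F = 2F ∷ 3F ∷ 1F ∷ 0F ∷ 2F ∷ 3F ∷ 1F ∷ 3F ∷ []
  C : Fin 2 → Fin 16 → Vertex 4
  C i t = vertexAt (half i ++ half i) (start i) (toℕ t)
  ℓ : Fin 2 → Fin 16 → Fin 4
  ℓ i t = letterAt 0F (half i ++ half i) (toℕ t)

-- The induction on m and n

record Design (m n : ℕ) : Set where
  constructor design
  field
    {k} : ℕ
    quotient : Quotient n (suc m) k
    trail : Trail (Quotient.φ quotient) (2 ^ m)

DoubledDesign : ℕ → ℕ → Set
DoubledDesign m n = Σ (Design m n) λ D → Doubled (Quotient.φ (Design.quotient D)) (Trail.blocks (Design.trail D))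

toggle-power : ∀ m b → toggle (2 ^ suc m) b ≡ b
toggle-power m b = trans (cong (λ l → toggle (2 ^ m + l) b) (+-identityʳ (2 ^ m))) (toggle-double (2 ^ m) b)

addTwo : ∀ {m n} → Design (suc m) n → Design (suc m) (2 + n)
addTwo {m} (design Q T) = design (AddTwo.quotient Q T (toggle-power m)) (AddTwo.trail Q T (toggle-power m))

addTwo-doubled : ∀ {m n} → DoubledDesign (suc m) n → DoubledDesign (suc m) (2 + n)
addTwo-doubled {m} (design Q T , D) = addTwo (design Q T) , record
  { l = 2 ↑ʳ l
  ; d = 0F
  ; d' = 1F
  ; X = map (2 ↑ʳ_) (X ++ d ∷ d' ∷ [])
  ; rest = map (λ (a , A) → 2 ↑ʳ a , map (2 ↑ʳ_) A ++ 0F ∷ 1F ∷ []) rest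
  ; shape = trans (cong (map enlarge) shape) (cong (enlarge (l ∷ X ++ d ∷ d' ∷ []) ∷_) (enlarge-cons rest))
  ; same = λ { (false ∷ false ∷ x) → refl ; (false ∷ true ∷ x) → refl ; (true ∷ false ∷ x) → refl ; (true ∷ true ∷ x) → refl }
  }
  where
  open Doubled D
  open AddTwo Q T (toggle-power m)
  enlarge-cons : ∀ t → map enlarge (map cons t) ≡ map cons (map (λ (a , A) → 2 ↑ʳ a , map (2 ↑ʳ_) A ++ 0F ∷ 1F ∷ []) t)
  enlarge-cons [] = refl
  enlarge-cons (_ ∷ t) = cong (_ ∷_) (enlarge-cons t)

addFour : ∀ {m n} → DoubledDesign (suc m) n → DoubledDesign (suc (suc m)) (4 + n)
addFour {m} {n} (design Q T , D) = retype (cong (2 ^ suc m +_) (sym (+-identityʳ (2 ^ suc m)))) trail doubled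
  where
  open AddFour Q T D (toggle-power m)
  retype : 2 ^ suc m + 2 ^ suc m ≡ 2 ^ suc (suc m) → (T : Trail φ' (2 ^ suc m + 2 ^ suc m)) →
    Doubled φ' (Trail.blocks T) → DoubledDesign (suc (suc m)) (4 + n)
  retype eq T D = design quotient (subst (Trail φ') eq T) , moved eq
    where
    moved : ∀ {K} (eq : _ ≡ K) → Doubled φ' (Trail.blocks (subst (Trail φ') eq T))
    moved refl = D

design₁ : ∀ j → Design 1 ((j + 1) * 2)
design₁ zero = design quotient₂ trail₂
design₁ (suc j) = addTwo (design₁ j)

design₂ : ∀ j → Design 2 ((j + 3) * 2)
design₂ zero = design quotient₆ trail₆
design₂ (suc j) = addTwo (design₂ j)

design₃ : ∀ j → DoubledDesign 3 ((j + 4) * 2)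
design₃ zero = design quotient₈ trail₈ , doubled₈
design₃ (suc j) = addTwo-doubled (design₃ j)

-- Here `h` is half the dimension, so the four new letters account for 2. The bound passes down
-- because `2 + 2 ^ (2 + m)` is at most `2 ^ (3 + m)`. At the bottom, `m = 3` in the theorem, all
-- `h` from 4 on come from the word for (3 , 8) by adding two letters at a time.
doubledDesign : ∀ m h → 2 ^ (2 + m) ≤ h → DoubledDesign (3 + m) (h * 2)
doubledDesign zero h 4≤h = subst (λ h → DoubledDesign 3 (h * 2)) (m∸n+n≡m 4≤h) (design₃ (h ∸ 4))
doubledDesign (suc m) (suc (suc h)) le = addFour (doubledDesign m h (+-cancelˡ-≤ 2 (2 ^ (2 + m)) h (≤-trans
  (+-mono-≤ {2} {2 ^ (2 + m)} (^-monoʳ-≤ 2 {1} {2 + m} (s≤s z≤n)) (m≤m+n (2 ^ (2 + m)) 0)) le)))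
doubledDesign (suc m) zero le = contradiction (≤-trans (^-monoʳ-≤ 2 {1} {3 + m} (s≤s z≤n)) le) λ ()
doubledDesign (suc m) (suc zero) le = contradiction (≤-trans (^-monoʳ-≤ 2 {1} {3 + m} (s≤s z≤n)) le) λ { (s≤s ()) }

design⇒decomposes : ∀ {m n} → Design (suc m) n → Decomposes (suc m) n (n ∸ 1 ∸ suc m)
design⇒decomposes {m} (design {k} Q T) = go Q T (Quotient.dim Q)
  where
  go : ∀ {n} (Q : Quotient n (suc (suc m)) k) → Trail (Quotient.φ Q) (2 ^ suc m) → suc (suc m) + k ≡ n →
    Decomposes (suc m) n (n ∸ 1 ∸ suc m)
  go Q T refl = subst (Decomposes (suc m) _) (sym (m+n∸m≡n (suc m) k)) (trail⇒decomposes (s≤s z≤n) (s≤s z≤n) Q T)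

decomposes-even : ∀ m h → 2 ^ m ≤ h → Decomposes (suc m) (h * 2) (h * 2 ∸ 1 ∸ suc m)
decomposes-even 0 h le = design⇒decomposes (subst (λ h → Design 1 (h * 2)) (m∸n+n≡m le) (design₁ (h ∸ 1)))
decomposes-even 1 h le with m≤n⇒m<n∨m≡n le
... | inj₁ lt = design⇒decomposes (subst (λ h → Design 2 (h * 2)) (m∸n+n≡m lt) (design₂ (h ∸ 3)))
... | inj₂ refl = decomposes₂₄
decomposes-even (suc (suc m)) h le = design⇒decomposes (proj₁ (doubledDesign m h le))

theorem1p6 : (m n : ℕ) → 1 ≤ m → 2 ^ m ≤ n → 2 ∣ n →
    ∃[ C ] ∃[ e ]
    (IsCycleDecomposition n (2 ^ (n ∸ 1 ∸ m)) (2 ^ m * n) C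
    × (∀ i → PropertyI (C i) (e i) n)
    × IsPerfectMatching n (2 ^ (n ∸ 1 ∸ m)) (2 ^ m) e)
theorem1p6 (suc m) _ _ le (divides h refl) =
  decomposes-even m h (*-cancelʳ-≤ (2 ^ m) h 2 (≤-trans (≤-reflexive (*-comm (2 ^ m) 2)) le))
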